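{- Let $n\ge1$ and let $\Gamma_n$, $d$, $\Lambda_n$ and the labeling $p\mapsto\sigma_p$ be as follows: $\Gamma_n$ is the Cayley graph of $S_n$ generated by all transpositions with graph metric $d$; $\Lambda_n$ is the set of permutations $\sigma_p$ where $p$ ranges over noncrossing partitions of $\{1,\dots,n\}$ and $\sigma_p$ has as cycles the blocks of $p$, each written in increasing order; and $d_\Lambda(\sigma,\tau)$ is the length of a shortest path from $\sigma$ to $\tau$ in the Hasse diagram of the refinement order on noncrossing partitions (equivalently, a shortest path in $\Gamma_n$ all of whose vertices lie in $\Lambda_n$). For $\sigma,\tau\in\Lambda_n$, place $2n$ points on a horizontal line in the order $L_1,R_1,L_2,R_2,\dots,L_n,R_n$; in the upper half-plane draw pairwise disjoint arcs joining $R_i$ to $L_{\sigma(i)}$ for each $i$, and in the lower half-plane draw pairwise disjoint arcs joining $R_i$ to $L_{\tau(i)}$ for each $i$ (this is possible since $\sigma,\tau\in\Lambda_n$). The union is a disjoint collection of simple closed curves (a system of meanders); let $\Pi_0(\sigma,\tau)$ be the number of its connected components. Then for any $\sigma,\tau\in\Lambda_n$ and any integer $k$, the following are equivalent: (1) $\Pi_0(\sigma,\tau)=k$; (2) $d(\sigma,\tau)=n-k$; (3) $d_\Lambda(\sigma,\tau)=n-k$. In particular, $(\sigma,\tau)$ determines a meander (a single closed curve) if and only if $d(\sigma,\tau)=d_\Lambda(\sigma,\tau)=n-1$.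
   Context: A partition of $\{1,\dots,n\}$ is noncrossing if whenever $i<j<k<\ell$ with $i\sim k$ and $j\sim\ell$, all four lie in one block. The refinement order: $p\preceq q$ if each block of $p$ lies in a block of $q$; the Hasse diagram joins $p,q$ when one covers the other (differs by splitting one block into two). Permutations act on the left (composition right-to-left). The points $L_i,R_i$ are the $2n$ transverse intersection points of the curves with the horizontal line. -}

module Defs where

open import Level using (0ℓ)
open import Data.Nat using (ℕ; zero; suc; _≤_)
open import Data.Integer using (ℤ; +_)
open import Data.Fin using (Fin; _<_)
open import Data.Fin.Permutation using (Permutation′; _⟨$⟩ʳ_; transpose)
import Data.Fin.Permutation as Perm
open import Data.Sum using (_⊎_; inj₁; inj₂)
open import Data.Product using (Σ; _×_; _,_)
open import Relation.Binary.PropositionalEquality using (_≡_; _≢_)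
open import Relation.Binary.Construct.Closure.ReflexiveTransitive using (Star)
open import Relation.Nullary using (¬_)
open import Data.Empty using (⊥)
open import Function.Bundles using (_⇔_)
open import Function.Definitions using (Surjective)

-- Generic graph distance: walks and shortest walks.
-- Vertices carry an equivalence _≈_ (the identity of vertices).

data Walk {V : Set} (_≈_ : V → V → Set) (Adj : V → V → Set) : V → V → ℕ → Set where
  here : ∀ {x y} → x ≈ y → Walk _≈_ Adj x y zero
  step : ∀ {x y z m} → Adj x y → Walk _≈_ Adj y z m → Walk _≈_ Adj x z (suc m)

IsDist : {V : Set} (_≈_ : V → V → Set) (Adj : V → V → Set) → V → V → ℕ → Set
IsDist _≈_ Adj x y m = Walk _≈_ Adj x y m × (∀ l → Walk _≈_ Adj x y l → m ≤ l)

DistIs : {V : Set} (_≈_ : V → V → Set) (Adj : V → V → Set) → V → V → ℤ → Set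
DistIs _≈_ Adj x y z = Σ ℕ λ m → (z ≡ + m) × IsDist _≈_ Adj x y m

CayleyAdj : ∀ {n} → Permutation′ n → Permutation′ n → Set
CayleyAdj {n} σ τ =
  Σ (Fin n) λ i → Σ (Fin n) λ j → (i ≢ j) ×
    (∀ x → τ ⟨$⟩ʳ x ≡ transpose i j ⟨$⟩ʳ (σ ⟨$⟩ʳ x))

d≡ : ∀ {n} → Permutation′ n → Permutation′ n → ℤ → Set
d≡ = DistIs Perm._≈_ CayleyAdj

-- Set partitions of {1..n} (= Fin n), given by a block labelling:
-- i and j are in the same block iff p i ≡ p j.

Partition : ℕ → Set
Partition n = Fin n → Fin n

Noncrossing : ∀ {n} → Partition n → Set
Noncrossing {n} p = ∀ (i j k l : Fin n) → i < j → j < k → k < l →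
  p i ≡ p k → p j ≡ p l → p i ≡ p j

_⪯_ : ∀ {n} → Partition n → Partition n → Set
p ⪯ q = ∀ i j → p i ≡ p j → q i ≡ q j

SamePartition : ∀ {n} → Partition n → Partition n → Set
SamePartition p q = (p ⪯ q) × (q ⪯ p)

_≺_ : ∀ {n} → Partition n → Partition n → Set
p ≺ q = (p ⪯ q) × ¬ (q ⪯ p)

CoversNC : ∀ {n} → Partition n → Partition n → Set
CoversNC {n} p q = Noncrossing p × Noncrossing q × (p ≺ q) ×
  (∀ (r : Partition n) → Noncrossing r → p ≺ r → r ≺ q → ⊥)

HasseAdj : ∀ {n} → Partition n → Partition n → Set
HasseAdj p q = CoversNC p q ⊎ CoversNC q p

dΛ≡ : ∀ {n} → Partition n → Partition n → ℤ → Set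
dΛ≡ = DistIs SamePartition HasseAdj

-- σ_p : the permutation whose cycles are the blocks of p, each written
-- in increasing order: σ(a) is the next larger element of the block of
-- a, and the largest element of a block is sent to its smallest one.

IsSigma : ∀ {n} → Partition n → Permutation′ n → Set
IsSigma {n} p σ = ∀ (i : Fin n) →
  (p (σ ⟨$⟩ʳ i) ≡ p i) ×
  ( ( (i < σ ⟨$⟩ʳ i) ×
      (∀ j → p j ≡ p i → i < j → σ ⟨$⟩ʳ i Data.Fin.≤ j) )
  ⊎ ( (∀ j → p j ≡ p i → j Data.Fin.≤ i) ×
      (∀ j → p j ≡ p i → σ ⟨$⟩ʳ i Data.Fin.≤ j) ) )

-- The system of meanders of (σ,τ): points L_i = inj₁ i, R_i = inj₂ i;
-- upper arcs R_i — L_{σ(i)}, lower arcs R_i — L_{τ(i)}.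

Point : ℕ → Set
Point n = Fin n ⊎ Fin n

Arc : ∀ {n} → Permutation′ n → Permutation′ n → Point n → Point n → Set
Arc {n} σ τ u v =
  Σ (Fin n) λ i →
    ((u ≡ inj₂ i) × ((v ≡ inj₁ (σ ⟨$⟩ʳ i)) ⊎ (v ≡ inj₁ (τ ⟨$⟩ʳ i))))
  ⊎ ((v ≡ inj₂ i) × ((u ≡ inj₁ (σ ⟨$⟩ʳ i)) ⊎ (u ≡ inj₁ (τ ⟨$⟩ʳ i))))

SameCurve : ∀ {n} → Permutation′ n → Permutation′ n → Point n → Point n → Set
SameCurve σ τ = Star (Arc σ τ)

HasComponents : ∀ {n} → Permutation′ n → Permutation′ n → ℕ → Set
HasComponents {n} σ τ m =
  Σ (Point n → Fin m) λ c →
    Surjective _≡_ _≡_ c × (∀ u v → (c u ≡ c v) ⇔ SameCurve σ τ u v)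

Π₀≡ : ∀ {n} → Permutation′ n → Permutation′ n → ℤ → Set
Π₀≡ σ τ z = Σ ℕ λ m → (z ≡ + m) × HasComponents σ τ m

{-# OPTIONS --safe #-}
module Submission where

-- Lower bound: colour the points so that colours are constant on arcs. For
-- σ = τ there are n colours, and composing with a transposition costs at most
-- one, by identifying the two colours of the transposed points; so a walk of
-- length l in the Cayley graph forces at least n - l curves. A cover in the
-- Hasse diagram merges two blocks and multiplies σ_p by a transposition, so the
-- same bound holds for Hasse walks.
--
-- Upper bound, by induction on n: p has an upper arc joining neighbouring points,
-- i.e. an i with σ(i) = i or σ(i) = i + 1. Unless q has the same arc, the lower
-- arcs ending at these two points belong to one curve, and isolating i in q
-- (if σ(i) = i) or merging the blocks of i and i + 1 (if σ(i) = i + 1) is one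
-- Hasse step that splits this curve and gives q the arc too. Then the small
-- closed curve is deleted.

open import Defs
open import Data.Nat as ℕ using (ℕ; zero; suc; z≤n; s≤s; _+_; _≤_)
import Data.Nat.Properties as ℕ
open import Data.Integer using (ℤ; +_; -_; _-_)
import Data.Integer.Properties as ℤ
open import Algebra.Bundles using (module AbelianGroup)
open import Algebra.Properties.Group (AbelianGroup.group ℤ.+-0-abelianGroup) using (∙-cancelˡ)
open import Data.Fin as Fin using (Fin; zero; suc; toℕ; punchIn; punchOut; pinch; inject₁; fromℕ<)
open import Data.Fin.Properties as Fin using (_≟_; <-cmp; any?)
open import Data.Fin.Permutation using (Permutation′; _⟨$⟩ʳ_; _⟨$⟩ˡ_; transpose; remove; lift₀; _∘ₚ_; inverseˡ; inverseʳ; punchIn-permute)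
import Data.Fin.Permutation as Perm
import Data.Fin.Permutation.Components as PC
open import Data.Sum using (_⊎_; inj₁; inj₂)
open import Data.Product using (Σ; ∃; _×_; _,_; proj₁; proj₂)
open import Data.Empty using (⊥; ⊥-elim)
open import Data.Vec.Functional using (insertAt)
open import Data.Vec.Functional.Properties using (insertAt-lookup; insertAt-punchIn)
open import Function using (_∘_)
open import Function.Bundles using (_⇔_; mk⇔; module Equivalence)
import Relation.Binary.Construct.Closure.ReflexiveTransitive as Star
open import Relation.Nullary using (¬_; yes; no; contradiction)
open import Relation.Nullary.Decidable using (decidable-stable)
open import Relation.Binary.Definitions using (tri<; tri≈; tri>)
open import Relation.Binary.PropositionalEquality

-- Permutations and transpositions

permutation-injective : ∀ {n} (σ : Permutation′ n) {x y} → σ ⟨$⟩ʳ x ≡ σ ⟨$⟩ʳ y → x ≡ y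
permutation-injective σ e = trans (sym (inverseˡ σ)) (trans (cong (σ ⟨$⟩ˡ_) e) (inverseˡ σ))

transposeˡ : ∀ {n} (i j : Fin n) → transpose i j ⟨$⟩ʳ i ≡ j
transposeˡ i j with i ≟ i
... | yes _ = refl
... | no i≢i = contradiction refl i≢i

transposeʳ : ∀ {n} (i j : Fin n) → transpose i j ⟨$⟩ʳ j ≡ i
transposeʳ i j with j ≟ i
... | yes j≡i = j≡i
... | no _ with j ≟ j
...   | yes _ = refl
...   | no j≢j = contradiction refl j≢j

transpose-other : ∀ {n} (i j : Fin n) {k} → k ≢ i → k ≢ j → transpose i j ⟨$⟩ʳ k ≡ k
transpose-other i j {k} k≢i k≢j with k ≟ i
... | yes k≡i = contradiction k≡i k≢i
... | no _ with k ≟ j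
...   | yes k≡j = contradiction k≡j k≢j
...   | no _ = refl

transpose-sym : ∀ {n} (i j : Fin n) {x y} →
  y ≡ transpose i j ⟨$⟩ʳ x → x ≡ transpose j i ⟨$⟩ʳ y
transpose-sym i j refl = sym (PC.transpose-inverse j i)

-- Noncrossing partitions

SamePartition-refl : ∀ {n} {p : Partition n} → SamePartition p p
SamePartition-refl = (λ _ _ e → e) , (λ _ _ e → e)

SamePartition-sym : ∀ {n} {p q : Partition n} → SamePartition p q → SamePartition q p
SamePartition-sym (f , g) = g , f

SamePartition-trans : ∀ {n} {p q r : Partition n} →
  SamePartition p q → SamePartition q r → SamePartition p r
SamePartition-trans (f , g) (h , k) = (λ x y → h x y ∘ f x y) , (λ x y → g x y ∘ k x y)

Between : ∀ {n} → Fin n → Fin n → Fin n → Set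
Between u v x = (u Fin.< x) × (x Fin.< v)

-- A pair `u`, `v` in one block acts as a chord that no other block can cross: if `y` were outside,
-- the pairs `u`, `v` and `x`, `y` would interleave, and noncrossing would put `x` into the block of
-- `u`.
noncrossing-between : ∀ {n} {p : Partition n} → Noncrossing p →
  ∀ {u v x y} → p u ≡ p v → p x ≡ p y → p x ≢ p u → Between u v x → Between u v y
noncrossing-between {p = p} nc {u} {v} {x} {y} uv xy x≁u (u<x , x<v)
  with <-cmp y u | <-cmp y v
... | tri< y<u _ _ | _ = contradiction (trans xy (nc y u x v y<u u<x x<v (sym xy) uv)) x≁u
... | tri≈ _ refl _ | _ = contradiction xy x≁u
... | tri> _ _ u<y | tri< y<v _ _ = u<y , y<v
... | tri> _ _ u<y | tri≈ _ refl _ = contradiction (trans xy (sym uv)) x≁u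
... | tri> _ _ u<y | tri> _ _ v<y = contradiction (sym (nc u x v y u<x x<v v<y uv xy)) x≁u

-- The map `f` need only be weakly monotone: if it glues two consecutive ones of the four points,
-- these already share a block of `r`, and the conclusion follows without using `nc`. This covers
-- relabelling, deleting a point and doubling a point alike.
noncrossing-pullback : ∀ {m n} (p : Partition n) (f : Fin m → Fin n) (r : Partition m) →
  (∀ x y → x Fin.≤ y → f x Fin.≤ f y) →
  (∀ x y → r x ≡ r y → p (f x) ≡ p (f y)) →
  (∀ x y → p (f x) ≡ p (f y) → r x ≡ r y) →
  Noncrossing p → Noncrossing r
noncrossing-pullback p f r mono to from nc i j k l i<j j<k k<l ik jl
  with f i ≟ f j | f j ≟ f k | f k ≟ f l
... | yes e | _ | _ = from i j (cong p e)
... | no _ | yes e | _ = trans ik (sym (from j k (cong p e)))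
... | no _ | no _ | yes e = trans ik (trans (from k l (cong p e)) (sym jl))
... | no i≢j | no j≢k | no k≢l = from i j
  (nc (f i) (f j) (f k) (f l)
    (Fin.≤∧≢⇒< (mono i j (ℕ.<⇒≤ i<j)) i≢j)
    (Fin.≤∧≢⇒< (mono j k (ℕ.<⇒≤ j<k)) j≢k)
    (Fin.≤∧≢⇒< (mono k l (ℕ.<⇒≤ k<l)) k≢l)
    (to i k ik) (to j l jl))

noncrossing-resp : ∀ {n} {p q : Partition n} → SamePartition p q → Noncrossing p → Noncrossing q
noncrossing-resp {p = p} {q} (p⪯q , q⪯p) =
  noncrossing-pullback p (λ x → x) q (λ _ _ x≤y → x≤y) q⪯p p⪯q

-- Junk value (the last element) when v is not in the image of f.
first : ∀ {n m} → (Fin (suc n) → Fin m) → Fin m → Fin (suc n)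
first {zero} f v = zero
first {suc n} f v with f zero ≟ v
... | yes _ = zero
... | no _ = suc (first (f ∘ suc) v)

first-hit : ∀ {n m} (f : Fin (suc n) → Fin m) (v : Fin m) x → f x ≡ v → f (first f v) ≡ v
first-hit {zero} f v zero e = e
first-hit {suc n} f v x e with f zero ≟ v
... | yes e₀ = e₀
first-hit {suc n} f v zero e | no ≢v = contradiction e ≢v
first-hit {suc n} f v (suc x) e | no ≢v = first-hit (f ∘ suc) v x e

first-least : ∀ {n m} (f : Fin (suc n) → Fin m) (v : Fin m) x → f x ≡ v → first f v Fin.≤ x
first-least {zero} f v x e = z≤n
first-least {suc n} f v x e with f zero ≟ v
... | yes _ = z≤n
first-least {suc n} f v zero e | no ≢v = contradiction e ≢v
first-least {suc n} f v (suc x) e | no ≢v = s≤s (first-least (f ∘ suc) v x e)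

-- `Partition n` wants labels in `Fin n`, while restricting a partition leaves labels in a larger
-- set; naming each block by its least element repairs this.
relabel : ∀ {n m} → (Fin n → Fin m) → Partition n
relabel {zero} f ()
relabel {suc n} f x = first f (f x)

relabel-sound : ∀ {n m} (f : Fin n → Fin m) x y → relabel f x ≡ relabel f y → f x ≡ f y
relabel-sound {suc n} f x y e =
  trans (sym (first-hit f (f x) x refl)) (trans (cong f e) (first-hit f (f y) y refl))

relabel-complete : ∀ {n m} (f : Fin n → Fin m) x y → f x ≡ f y → relabel f x ≡ relabel f y
relabel-complete {suc n} f x y = cong (first f)

-- The permutation σ_p

sigma-block : ∀ {n} (p : Partition n) σ → IsSigma p σ → ∀ i → p (σ ⟨$⟩ʳ i) ≡ p i
sigma-block p σ s i = proj₁ (s i)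

sigma-next : ∀ {n} (p : Partition n) σ → IsSigma p σ → ∀ {i j} →
  p j ≡ p i → i Fin.< j → (i Fin.< σ ⟨$⟩ʳ i) × (σ ⟨$⟩ʳ i Fin.≤ j)
sigma-next p σ s {i} {j} e i<j with proj₂ (s i)
... | inj₁ (i< , least) = i< , least j e i<j
... | inj₂ (max , _) = contradiction (max j e) (ℕ.<⇒≱ i<j)

sigma-wrap : ∀ {n} (p : Partition n) σ → IsSigma p σ → ∀ {i j} →
  p j ≡ p i → σ ⟨$⟩ʳ i Fin.≤ i → (j Fin.≤ i) × (σ ⟨$⟩ʳ i Fin.≤ j)
sigma-wrap p σ s {i} {j} e σi≤i with proj₂ (s i)
... | inj₁ (i< , _) = contradiction σi≤i (ℕ.<⇒≱ i<)
... | inj₂ (max , min) = max j e , min j e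

sigma-fixed : ∀ {n} (p : Partition n) σ → IsSigma p σ → ∀ {i} → σ ⟨$⟩ʳ i ≡ i →
  ∀ {j} → p j ≡ p i → j ≡ i
sigma-fixed p σ s {i} fix {j} e with sigma-wrap p σ s e (ℕ.≤-reflexive (cong toℕ fix))
... | j≤i , σi≤j = Fin.≤-antisym j≤i (subst (Fin._≤ j) fix σi≤j)

-- The block of `x` in `p` is a subset of its block in `q`. If the cyclic successor within the
-- larger block lies in the smaller one, it is the successor there too.
sigma-agree : ∀ {n} (p q : Partition n) σ τ → IsSigma p σ → IsSigma q τ → p ⪯ q →
  ∀ x → p (τ ⟨$⟩ʳ x) ≡ p x → σ ⟨$⟩ʳ x ≡ τ ⟨$⟩ʳ x
sigma-agree p q σ τ s t p⪯q x e with proj₂ (s x) | proj₂ (t x)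
... | inj₁ (x<σx , leastσ) | inj₁ (x<τx , leastτ) =
  Fin.≤-antisym (leastσ _ e x<τx) (leastτ _ (p⪯q _ _ (sigma-block p σ s x)) x<σx)
... | inj₁ (x<σx , _) | inj₂ (max , _) =
  contradiction (max _ (p⪯q _ _ (sigma-block p σ s x))) (ℕ.<⇒≱ x<σx)
... | inj₂ (max , _) | inj₁ (x<τx , _) = contradiction (max _ e) (ℕ.<⇒≱ x<τx)
... | inj₂ (_ , minσ) | inj₂ (_ , minτ) =
  Fin.≤-antisym (minσ _ e) (minτ _ (p⪯q _ _ (sigma-block p σ s x)))

sigma-unique : ∀ {n} (p q : Partition n) σ τ → IsSigma p σ → IsSigma q τ →
  SamePartition p q → σ Perm.≈ τ
sigma-unique p q σ τ s t (p⪯q , q⪯p) x = sigma-agree p q σ τ s t p⪯q x (q⪯p _ _ (sigma-block q τ t x))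

-- Iterating `τ` from `x` climbs through the block of `q` without jumping over `y`. The number `g`
-- bounds the distance still to climb and makes the recursion structural.
sigma-generates-< : ∀ {n} (p q : Partition n) τ → IsSigma q τ →
  (∀ i → p (τ ⟨$⟩ʳ i) ≡ p i) → ∀ g x y → q x ≡ q y → x Fin.< y →
  toℕ y ℕ.≤ toℕ x + g → p x ≡ p y
sigma-generates-< p q τ t closed zero x y e x<y y≤ =
  contradiction (subst (toℕ y ℕ.≤_) (ℕ.+-identityʳ _) y≤) (ℕ.<⇒≱ x<y)
sigma-generates-< p q τ t closed (suc g) x y e x<y y≤ with sigma-next q τ t (sym e) x<y
... | x<τx , τx≤y with τ ⟨$⟩ʳ x ≟ y
...   | yes refl = sym (closed x)
...   | no τx≢y = trans (sym (closed x))
  (sigma-generates-< p q τ t closed g (τ ⟨$⟩ʳ x) y (trans (sigma-block q τ t x) e) (Fin.≤∧≢⇒< τx≤y τx≢y)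
    (ℕ.≤-trans y≤ (ℕ.≤-trans (ℕ.≤-reflexive (ℕ.+-suc _ g)) (ℕ.+-monoˡ-≤ g x<τx))))

sigma-generates : ∀ {n} (p q : Partition n) τ → IsSigma q τ →
  (∀ i → p (τ ⟨$⟩ʳ i) ≡ p i) → q ⪯ p
sigma-generates p q τ t closed x y e with <-cmp x y
... | tri≈ _ refl _ = refl
... | tri< x<y _ _ = sigma-generates-< p q τ t closed (toℕ y) x y e x<y (ℕ.m≤n+m _ _)
... | tri> _ _ y<x = sym (sigma-generates-< p q τ t closed (toℕ x) y x (sym e) y<x (ℕ.m≤n+m _ _))

-- Merging two blocks

-- A covering with explicit witnesses: exactly the two blocks of `a` and `b` are united.
-- `merge⇒covers` and `covers⇒merge` relate it to `CoversNC`; this form is easier to transport along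
-- constructions.
record Merge {n} (p q : Partition n) : Set where
  constructor mkMerge
  field
    noncrossing-fine   : Noncrossing p
    noncrossing-coarse : Noncrossing q
    refines            : p ⪯ q
    {a b}              : Fin n
    separated          : p a ≢ p b
    joined             : q a ≡ q b
    only-joined        : ∀ x y → q x ≡ q y →
      p x ≡ p y ⊎ (p x ≡ p a × p y ≡ p b) ⊎ (p x ≡ p b × p y ≡ p a)

MergeAdj : ∀ {n} → Partition n → Partition n → Set
MergeAdj p q = Merge p q ⊎ Merge q p

merge-resp : ∀ {n} {p p′ q q′ : Partition n} → SamePartition p p′ → SamePartition q q′ →
  Merge p q → Merge p′ q′
merge-resp {p = p} {p′} {q} {q′} pp′ qq′ (mkMerge np nq p⪯q {a} {b} a≁b a~b only) =
  mkMerge (noncrossing-resp pp′ np) (noncrossing-resp qq′ nq)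
    (λ x y e → proj₁ qq′ x y (p⪯q x y (proj₂ pp′ x y e)))
    (λ e → a≁b (proj₂ pp′ a b e)) (proj₁ qq′ a b a~b) split
  where
  split : ∀ x y → q′ x ≡ q′ y →
    p′ x ≡ p′ y ⊎ (p′ x ≡ p′ a × p′ y ≡ p′ b) ⊎ (p′ x ≡ p′ b × p′ y ≡ p′ a)
  split x y e with only x y (proj₂ qq′ x y e)
  ... | inj₁ xy = inj₁ (proj₁ pp′ x y xy)
  ... | inj₂ (inj₁ (xa , yb)) = inj₂ (inj₁ (proj₁ pp′ x a xa , proj₁ pp′ y b yb))
  ... | inj₂ (inj₂ (xb , ya)) = inj₂ (inj₂ (proj₁ pp′ x b xb , proj₁ pp′ y a ya))

-- An intermediate `r` either joins `a` and `b`, and is then as coarse as `q`, or separates them,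
-- and is then as fine as `p`.
merge⇒covers : ∀ {n} {p q : Partition n} → Merge p q → CoversNC p q
merge⇒covers {p = p} {q} (mkMerge np nq p⪯q {a} {b} a≁b a~b only) =
  np , nq , (p⪯q , λ q⪯p → a≁b (q⪯p a b a~b)) , no-intermediate
  where
  no-intermediate : ∀ r → Noncrossing r → p ≺ r → r ≺ q → ⊥
  no-intermediate r _ (p⪯r , r⋠p) (r⪯q , q⋠r) with r a ≟ r b
  ... | yes ab = q⋠r λ x y e → q⪯r x y (only x y e)
    where
    q⪯r : ∀ x y → p x ≡ p y ⊎ (p x ≡ p a × p y ≡ p b) ⊎ (p x ≡ p b × p y ≡ p a) → r x ≡ r y
    q⪯r x y (inj₁ xy) = p⪯r x y xy
    q⪯r x y (inj₂ (inj₁ (xa , yb))) = trans (p⪯r x a xa) (trans ab (sym (p⪯r y b yb)))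
    q⪯r x y (inj₂ (inj₂ (xb , ya))) = trans (p⪯r x b xb) (trans (sym ab) (sym (p⪯r y a ya)))
  ... | no a≁b = r⋠p λ x y e → r⪯p x y e (only x y (r⪯q x y e))
    where
    r⪯p : ∀ x y → r x ≡ r y →
      p x ≡ p y ⊎ (p x ≡ p a × p y ≡ p b) ⊎ (p x ≡ p b × p y ≡ p a) → p x ≡ p y
    r⪯p x y e (inj₁ xy) = xy
    r⪯p x y e (inj₂ (inj₁ (xa , yb))) =
      contradiction (trans (sym (p⪯r x a xa)) (trans e (p⪯r y b yb))) a≁b
    r⪯p x y e (inj₂ (inj₂ (xb , ya))) =
      contradiction (trans (sym (p⪯r y a ya)) (trans (sym e) (p⪯r x b xb))) a≁b

module _ {n : ℕ} (p : Partition n) (i j : Fin n) where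

  mergeBlocks : Partition n
  mergeBlocks x with p x ≟ p j
  ... | yes _ = p i
  ... | no _ = p x

  mergeBlocks-⪯ : p ⪯ mergeBlocks
  mergeBlocks-⪯ x y e with p x ≟ p j | p y ≟ p j
  ... | yes _ | yes _ = refl
  ... | no _ | no _ = e
  ... | yes xj | no y≁j = contradiction (trans (sym e) xj) y≁j
  ... | no x≁j | yes yj = contradiction (trans e yj) x≁j

  mergeBlocks-joined : mergeBlocks i ≡ mergeBlocks j
  mergeBlocks-joined with p i ≟ p j | p j ≟ p j
  ... | _ | no j≁j = contradiction refl j≁j
  ... | yes _ | yes _ = refl
  ... | no _ | yes _ = refl

  mergeBlocks-only : ∀ x y → mergeBlocks x ≡ mergeBlocks y →
    p x ≡ p y ⊎ (p x ≡ p i × p y ≡ p j) ⊎ (p x ≡ p j × p y ≡ p i)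
  mergeBlocks-only x y e with p x ≟ p j | p y ≟ p j
  ... | yes xj | yes yj = inj₁ (trans xj (sym yj))
  ... | yes xj | no _ = inj₂ (inj₂ (xj , sym e))
  ... | no _ | yes yj = inj₂ (inj₁ (e , yj))
  ... | no _ | no _ = inj₁ e

  -- The hypothesis says that no chord of a third block separates `i` from `j`. Of two crossing
  -- pairs from different new blocks, at least one is a chord of `p`, since otherwise both would
  -- belong to the merged block; and a chord of `p` has every other new block entirely on one side.
  mergeBlocks-noncrossing : Noncrossing p →
    (∀ u v → p u ≡ p v → p u ≢ p i → p u ≢ p j →
      (Between u v i → Between u v j) × (Between u v j → Between u v i)) →
    Noncrossing mergeBlocks
  mergeBlocks-noncrossing np same-side a b c d a<b b<c c<d ac bd
    with mergeBlocks a ≟ mergeBlocks b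
  ... | yes ab = ab
  ... | no a≁b = ⊥-elim (cases (mergeBlocks-only a c ac) (mergeBlocks-only b d bd))
    where
    r = mergeBlocks

    -- This extends `noncrossing-between` to the merged block: to pass from one old block to the
    -- other, go through `i` and `j`, which `same-side` keeps together.
    between : ∀ {u v x y} → p u ≡ p v → r x ≡ r y → r x ≢ r u → Between u v x → Between u v y
    between {u} {v} {x} {y} uv xy x≁u btw with mergeBlocks-only x y xy
    ... | inj₁ pxy = noncrossing-between np uv pxy (x≁u ∘ mergeBlocks-⪯ x u) btw
    ... | inj₂ (inj₁ (xi , yj)) = noncrossing-between np uv (sym yj) (u≁j ∘ sym)
      (proj₁ (same-side u v uv u≁i u≁j)
        (noncrossing-between np uv xi (x≁u ∘ mergeBlocks-⪯ x u) btw))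
      where
      u≁i : p u ≢ p i
      u≁i e = x≁u (mergeBlocks-⪯ x u (trans xi (sym e)))
      u≁j : p u ≢ p j
      u≁j e = x≁u (trans xy (mergeBlocks-⪯ y u (trans yj (sym e))))
    ... | inj₂ (inj₂ (xj , yi)) = noncrossing-between np uv (sym yi) (u≁i ∘ sym)
      (proj₂ (same-side u v uv u≁i u≁j)
        (noncrossing-between np uv xj (x≁u ∘ mergeBlocks-⪯ x u) btw))
      where
      u≁j : p u ≢ p j
      u≁j e = x≁u (mergeBlocks-⪯ x u (trans xj (sym e)))
      u≁i : p u ≢ p i
      u≁i e = x≁u (trans xy (mergeBlocks-⪯ y u (trans yi (sym e))))

    ac-chord : p a ≡ p c → ⊥
    ac-chord e = ℕ.<-asym c<d (proj₂ (between e bd (a≁b ∘ sym) (a<b , b<c)))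

    bd-chord : p b ≡ p d → ⊥
    bd-chord e = ℕ.<-asym a<b (proj₁ (between e (sym ac) (a≁b ∘ trans ac) (b<c , c<d)))

    cases : p a ≡ p c ⊎ (p a ≡ p i × p c ≡ p j) ⊎ (p a ≡ p j × p c ≡ p i) →
      p b ≡ p d ⊎ (p b ≡ p i × p d ≡ p j) ⊎ (p b ≡ p j × p d ≡ p i) → ⊥
    cases (inj₁ e) _ = ac-chord e
    cases (inj₂ _) (inj₁ e) = bd-chord e
    cases (inj₂ (inj₁ (ai , _))) (inj₂ (inj₁ (bi , _))) = a≁b (mergeBlocks-⪯ a b (trans ai (sym bi)))
    cases (inj₂ (inj₂ (aj , _))) (inj₂ (inj₂ (bj , _))) = a≁b (mergeBlocks-⪯ a b (trans aj (sym bj)))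
    cases (inj₂ (inj₁ (ai , cj))) (inj₂ (inj₂ (bj , _))) =
      a≁b (trans ac (mergeBlocks-⪯ c b (trans cj (sym bj))))
    cases (inj₂ (inj₂ (aj , ci))) (inj₂ (inj₁ (bi , _))) =
      a≁b (trans ac (mergeBlocks-⪯ c b (trans ci (sym bi))))

  mergeBlocks-merge : Noncrossing p → p i ≢ p j → Noncrossing mergeBlocks → Merge p mergeBlocks
  mergeBlocks-merge np i≁j nr = mkMerge np nr mergeBlocks-⪯ i≁j mergeBlocks-joined mergeBlocks-only

-- No element of the block of i lies cyclically between i and its successor.
sigma-same-side : ∀ {n} (q : Partition n) τ → IsSigma q τ → ∀ {i u v} →
  q u ≡ q i → q v ≡ q i → u ≢ i → v ≢ i → u ≢ τ ⟨$⟩ʳ i → v ≢ τ ⟨$⟩ʳ i →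
  (Between u v i → Between u v (τ ⟨$⟩ʳ i)) × (Between u v (τ ⟨$⟩ʳ i) → Between u v i)
sigma-same-side q τ t {i} {u} {v} ui vi u≢i v≢i u≢τi v≢τi = to , from
  where
  to : Between u v i → Between u v (τ ⟨$⟩ʳ i)
  to (u<i , i<v) with sigma-next q τ t vi i<v
  ... | i<τi , τi≤v = ℕ.<-trans u<i i<τi , Fin.≤∧≢⇒< τi≤v (v≢τi ∘ sym)

  from : Between u v (τ ⟨$⟩ʳ i) → Between u v i
  from (u<τi , τi<v) with ℕ.≤-<-connex (toℕ (τ ⟨$⟩ʳ i)) (toℕ i)
  ... | inj₁ τi≤i = contradiction (proj₂ (sigma-wrap q τ t ui τi≤i)) (ℕ.<⇒≱ u<τi)
  ... | inj₂ i<τi with <-cmp u i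
  ...   | tri< u<i _ _ = u<i , ℕ.<-trans i<τi τi<v
  ...   | tri≈ _ u≡i _ = contradiction u≡i u≢i
  ...   | tri> _ _ i<u = contradiction (proj₂ (sigma-next q τ t ui i<u)) (ℕ.<⇒≱ u<τi)

-- Covers are merges, and merges are transpositions

exit : ∀ {n} (p q : Partition n) τ → IsSigma q τ → ¬ (q ⪯ p) → ∃ λ i → p (τ ⟨$⟩ʳ i) ≢ p i
exit p q τ t q⋠p = Fin.¬∀⟶∃¬ _ _ (λ i → p (τ ⟨$⟩ʳ i) ≟ p i) λ closed →
  q⋠p (sigma-generates p q τ t closed)

-- Choose `i` where `τ` leaves a block of `p`. Merging the blocks of `i` and `τ i` stays
-- noncrossing, lies strictly above `p` and below `q`, so by the covering property it is `q`.
covers⇒merge : ∀ {n} (p q : Partition n) τ → IsSigma q τ → CoversNC p q → Merge p q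
covers⇒merge p q τ t (np , nq , (p⪯q , q⋠p) , none) with exit p q τ t q⋠p
... | i , i≁τi =
  merge-resp SamePartition-refl (r⪯q , q⪯r) (mergeBlocks-merge p i j np (i≁τi ∘ sym) nr)
  where
  j = τ ⟨$⟩ʳ i
  r = mergeBlocks p i j
  qj = sigma-block q τ t i

  nr : Noncrossing r
  nr = mergeBlocks-noncrossing p i j np same-side
    where
    same-side : ∀ u v → p u ≡ p v → p u ≢ p i → p u ≢ p j →
      (Between u v i → Between u v j) × (Between u v j → Between u v i)
    -- A chord inside the block of `i` in `q` cannot separate `i` from its cyclic successor; a chord
    -- of another block of `q` cannot because `q` is noncrossing.
    same-side u v uv u≁i u≁j with q u ≟ q i
    ... | yes ui = sigma-same-side q τ t ui (trans (sym (p⪯q u v uv)) ui)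
      (u≁i ∘ cong p) (u≁i ∘ trans uv ∘ cong p) (u≁j ∘ cong p) (u≁j ∘ trans uv ∘ cong p)
    ... | no u≁qi =
      noncrossing-between nq (p⪯q u v uv) (sym qj) (u≁qi ∘ sym) ,
      noncrossing-between nq (p⪯q u v uv) qj (λ e → u≁qi (trans (sym e) qj))

  r⪯q : r ⪯ q
  r⪯q x y e with mergeBlocks-only p i j x y e
  ... | inj₁ xy = p⪯q x y xy
  ... | inj₂ (inj₁ (xi , yj)) = trans (p⪯q x i xi) (trans (sym qj) (sym (p⪯q y j yj)))
  ... | inj₂ (inj₂ (xj , yi)) = trans (p⪯q x j xj) (trans qj (sym (p⪯q y i yi)))

  p≺r : p ≺ r
  p≺r = mergeBlocks-⪯ p i j , λ r⪯p → i≁τi (sym (r⪯p i j (mergeBlocks-joined p i j)))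

  q⪯r : q ⪯ r
  q⪯r x y e = decidable-stable (r x ≟ r y) λ x≁y →
    none r nr p≺r (r⪯q , λ q⪯r → x≁y (q⪯r x y e))

-- After `x` comes `τ x`, strictly before `y`; then `τ y` lies beyond `y` or wraps around to a point
-- before `x`. Either way the pairs `x`, `y` and `τ x`, `τ y` interleave, so `p` would have to put
-- them in one block.
exit-unique-< : ∀ {n} (p q : Partition n) τ → IsSigma q τ → Noncrossing p → p ⪯ q →
  ∀ x y → p x ≡ p y → p (τ ⟨$⟩ʳ x) ≡ p (τ ⟨$⟩ʳ y) → p (τ ⟨$⟩ʳ x) ≢ p x → ¬ (x Fin.< y)
exit-unique-< p q τ t np p⪯q x y xy τxy exits x<y with sigma-next q τ t (p⪯q y x (sym xy)) x<y
... | x<τx , τx≤y with Fin.≤∧≢⇒< τx≤y (λ e → exits (trans (cong p e) (sym xy)))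
...   | τx<y with ℕ.≤-<-connex (toℕ (τ ⟨$⟩ʳ y)) (toℕ y)
...     | inj₂ y<τy = exits (sym (np x _ y _ x<τx τx<y y<τy xy τxy))
...     | inj₁ τy≤y = exits (trans τxy (np _ x _ y
            (Fin.≤∧≢⇒< (proj₂ (sigma-wrap q τ t (p⪯q x y xy) τy≤y))
              (λ e → exits (trans τxy (cong p e))))
            x<τx τx<y (sym τxy) xy))

exit-unique : ∀ {n} (p q : Partition n) τ → IsSigma q τ → Noncrossing p → p ⪯ q →
  ∀ x y → p x ≡ p y → p (τ ⟨$⟩ʳ x) ≡ p (τ ⟨$⟩ʳ y) → p (τ ⟨$⟩ʳ x) ≢ p x → x ≡ y
exit-unique p q τ t np p⪯q x y xy τxy exits with <-cmp x y
... | tri≈ _ e _ = e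
... | tri< x<y _ _ = ⊥-elim (exit-unique-< p q τ t np p⪯q x y xy τxy exits x<y)
... | tri> _ _ y<x = ⊥-elim (exit-unique-< p q τ t np p⪯q y x (sym xy) (sym τxy)
        (λ e → exits (trans τxy (trans e (sym xy)))) y<x)

-- τ exits exactly once from each of the two merged blocks.
merge⇒transpose : ∀ {n} (p q : Partition n) σ τ → IsSigma p σ → IsSigma q τ → Merge p q →
  ∀ i → p (τ ⟨$⟩ʳ i) ≢ p i →
  ∀ x → τ ⟨$⟩ʳ x ≡ transpose (σ ⟨$⟩ʳ i) (τ ⟨$⟩ʳ i) ⟨$⟩ʳ (σ ⟨$⟩ʳ x)
merge⇒transpose p q σ τ s t (mkMerge np nq p⪯q {a} {b} a≁b a~b only) i exits = conclude
  where
  two-blocks : ∀ x y → q x ≡ q i → q y ≡ q i → p x ≢ p i → p y ≢ p i → p x ≡ p y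
  two-blocks x y xi yi x≁i y≁i with only x i xi | only y i yi
  ... | inj₁ e | _ = contradiction e x≁i
  ... | _ | inj₁ e = contradiction e y≁i
  ... | inj₂ (inj₁ (xa , _)) | inj₂ (inj₁ (ya , _)) = trans xa (sym ya)
  ... | inj₂ (inj₂ (xb , _)) | inj₂ (inj₂ (yb , _)) = trans xb (sym yb)
  ... | inj₂ (inj₁ (_ , ib)) | inj₂ (inj₂ (_ , ia)) = contradiction (trans (sym ia) ib) a≁b
  ... | inj₂ (inj₂ (_ , ia)) | inj₂ (inj₁ (_ , ib)) = contradiction (trans (sym ia) ib) a≁b

  agree : ∀ x → p (τ ⟨$⟩ʳ x) ≡ p x → σ ⟨$⟩ʳ x ≡ τ ⟨$⟩ʳ x
  agree = sigma-agree p q σ τ s t p⪯q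

  -- This is the point where `τ` leaves the other merged block: `σ w = τ i` by choice, and
  -- `τ w = σ i` is shown below, so `τ` differs from `σ` by swapping these two values.
  w : Fin _
  w = σ ⟨$⟩ˡ (τ ⟨$⟩ʳ i)
  σw : σ ⟨$⟩ʳ w ≡ τ ⟨$⟩ʳ i
  σw = inverseʳ σ
  w~τi : p w ≡ p (τ ⟨$⟩ʳ i)
  w~τi = trans (sym (sigma-block p σ s w)) (cong p σw)
  w≁i : p w ≢ p i
  w≁i e = exits (trans (sym w~τi) e)
  q-w : q w ≡ q i
  q-w = trans (p⪯q _ _ w~τi) (sigma-block q τ t i)
  w-exits : p (τ ⟨$⟩ʳ w) ≢ p w
  w-exits e = w≁i (cong p (permutation-injective τ (trans (sym (agree w e)) σw)))

  exit-from-other : ∀ x → q x ≡ q i → p x ≢ p i → p (τ ⟨$⟩ʳ x) ≢ p x → x ≡ w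
  exit-from-other x xi x≁i x-exits = exit-unique p q τ t np p⪯q x w (sym wx) back x-exits
    where
    wx = two-blocks w x q-w xi w≁i x≁i
    returns : ∀ y → q y ≡ q i → p y ≢ p i → p (τ ⟨$⟩ʳ y) ≢ p y → p (τ ⟨$⟩ʳ y) ≡ p i
    returns y yi y≁i y-exits with p (τ ⟨$⟩ʳ y) ≟ p i
    ... | yes e = e
    ... | no τy≁i = contradiction
      (two-blocks _ y (trans (sigma-block q τ t y) yi) yi τy≁i y≁i) y-exits
    back = trans (returns x xi x≁i x-exits) (sym (returns w q-w w≁i w-exits))

  -- The point that `τ` sends to `σ i` cannot lie in the block of `i`, where it would have to be `i`
  -- itself. So `τ` leaves the other block there, and uniqueness of the exit makes it `w`.
  τw : τ ⟨$⟩ʳ w ≡ σ ⟨$⟩ʳ i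
  τw = trans (cong (τ ⟨$⟩ʳ_) (sym v≡w)) τv
    where
    v = τ ⟨$⟩ˡ (σ ⟨$⟩ʳ i)
    τv : τ ⟨$⟩ʳ v ≡ σ ⟨$⟩ʳ i
    τv = inverseʳ τ
    τv~i : p (τ ⟨$⟩ʳ v) ≡ p i
    τv~i = trans (cong p τv) (sigma-block p σ s i)
    v≁i : p v ≢ p i
    v≁i vi = exits (trans (cong p (trans (cong (τ ⟨$⟩ʳ_) (sym v≡i)) τv)) (sigma-block p σ s i))
      where
      v≡i : v ≡ i
      v≡i = permutation-injective σ (trans (agree v (trans τv~i (sym vi))) τv)
    v≡w : v ≡ w
    v≡w = exit-from-other v (trans (sym (sigma-block q τ t v)) (p⪯q _ _ τv~i)) v≁i
      (λ e → v≁i (trans (sym e) τv~i))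

  conclude : ∀ x → τ ⟨$⟩ʳ x ≡ transpose (σ ⟨$⟩ʳ i) (τ ⟨$⟩ʳ i) ⟨$⟩ʳ (σ ⟨$⟩ʳ x)
  conclude x with x ≟ i | x ≟ w
  ... | yes refl | _ = sym (transposeˡ (σ ⟨$⟩ʳ i) (τ ⟨$⟩ʳ i))
  ... | no _ | yes refl = trans τw (sym (trans (cong (transpose (σ ⟨$⟩ʳ i) (τ ⟨$⟩ʳ i) ⟨$⟩ʳ_) σw)
    (transposeʳ (σ ⟨$⟩ʳ i) (τ ⟨$⟩ʳ i))))
  ... | no x≢i | no x≢w = sym (trans
    (transpose-other (σ ⟨$⟩ʳ i) (τ ⟨$⟩ʳ i) (x≢i ∘ permutation-injective σ)
      (λ e → x≢w (permutation-injective σ (trans e (sym σw)))))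
    (agree x stays))
    where
    -- An exit at `x` goes either in the direction of the exit at `i` or in the opposite direction;
    -- uniqueness would make `x` equal to `i` or to `w`.
    stays : p (τ ⟨$⟩ʳ x) ≡ p x
    stays with p (τ ⟨$⟩ʳ x) ≟ p x
    ... | yes e = e
    ... | no x-exits with only (τ ⟨$⟩ʳ x) x (sigma-block q τ t x) | only (τ ⟨$⟩ʳ i) i (sigma-block q τ t i)
    ...   | inj₁ e | _ = e
    ...   | _ | inj₁ e = contradiction e exits
    ...   | inj₂ (inj₁ (τxa , xb)) | inj₂ (inj₁ (τia , ib)) = contradiction
      (exit-unique p q τ t np p⪯q x i (trans xb (sym ib)) (trans τxa (sym τia)) x-exits) x≢i
    ...   | inj₂ (inj₂ (τxb , xa)) | inj₂ (inj₂ (τib , ia)) = contradiction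
      (exit-unique p q τ t np p⪯q x i (trans xa (sym ia)) (trans τxb (sym τib)) x-exits) x≢i
    ...   | inj₂ (inj₁ (τxa , xb)) | inj₂ (inj₂ (τib , ia)) = contradiction
      (exit-from-other x (trans (p⪯q x b xb) (trans (sym a~b) (sym (p⪯q i a ia))))
        (λ e → a≁b (trans (sym ia) (trans (sym e) xb))) x-exits) x≢w
    ...   | inj₂ (inj₂ (τxb , xa)) | inj₂ (inj₁ (τia , ib)) = contradiction
      (exit-from-other x (trans (p⪯q x a xa) (trans a~b (sym (p⪯q i b ib))))
        (λ e → a≁b (trans (sym xa) (trans e ib))) x-exits) x≢w

-- Induction by removing the least point. If it is alone in its block, it becomes a fixed point.
-- Otherwise it is inserted into the cycle just before `m`, the least other member of its block, by
-- composing with a transposition.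
sigma-exists : ∀ {n} (p : Partition n) → Σ (Permutation′ n) (IsSigma p)
sigma-exists {zero} p = Perm.id , λ ()
sigma-exists {suc n} p with sigma-exists (relabel (p ∘ suc)) | any? (λ y → p (suc y) ≟ p zero)
... | ρ , s | no alone = lift₀ ρ , isSigma
  where
  isSigma : IsSigma p (lift₀ ρ)
  isSigma zero = refl , inj₂ (max , λ _ _ → z≤n)
    where
    max : ∀ j → p j ≡ p zero → j Fin.≤ zero {n}
    max zero _ = z≤n
    max (suc j) e = contradiction (j , e) alone
  isSigma (suc x) = relabel-sound (p ∘ suc) _ _ (proj₁ (s x)) , next (proj₂ (s x))
    where
    next : _ → _
    next (inj₁ (x<ρx , least)) = inj₁ (s≤s x<ρx , λ
      { (suc j) e (s≤s x<j) → s≤s (least j (relabel-complete (p ∘ suc) _ _ e) x<j) })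
    next (inj₂ (max , min)) = inj₂ (
      (λ { zero _ → z≤n
         ; (suc j) e → s≤s (max j (relabel-complete (p ∘ suc) _ _ e)) }) ,
      (λ { zero e → contradiction (x , sym e) alone
         ; (suc j) e → s≤s (min j (relabel-complete (p ∘ suc) _ _ e)) }))
sigma-exists {suc (suc n)} p | ρ , s | yes (y , hit) = σ , isSigma
  where
  m = first (p ∘ suc) (p zero)
  pm : p (suc m) ≡ p zero
  pm = first-hit (p ∘ suc) (p zero) y hit
  m-least : ∀ j → p (suc j) ≡ p zero → m Fin.≤ j
  m-least = first-least (p ∘ suc) (p zero)
  σ = lift₀ ρ ∘ₚ transpose zero (suc m)

  isSigma : IsSigma p σ
  isSigma zero = pm , inj₁ (s≤s z≤n , λ { (suc j) e _ → s≤s (m-least j e) })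
  isSigma (suc x) with ρ ⟨$⟩ʳ x ≟ m
  -- Here `x` precedes the least element `m` in its cycle, so it is the largest element of its block
  -- and must now wrap around to `zero`.
  ... | yes ρx≡m = sym px , inj₂ (max , λ _ _ → z≤n)
    where
    px : p (suc x) ≡ p zero
    px = trans (sym (relabel-sound (p ∘ suc) _ _ (proj₁ (s x)))) (trans (cong (p ∘ suc) ρx≡m) pm)
    max : ∀ j → p j ≡ p (suc x) → j Fin.≤ suc x
    max zero _ = z≤n
    max (suc j) e with proj₂ (s x)
    ... | inj₂ (max′ , _) = s≤s (max′ j (relabel-complete (p ∘ suc) _ _ e))
    ... | inj₁ (x<ρx , _) = contradiction (m-least x px)
      (ℕ.<⇒≱ (subst (x Fin.<_) ρx≡m x<ρx))
  ... | no ρx≢m = relabel-sound (p ∘ suc) _ _ (proj₁ (s x)) , next (proj₂ (s x))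
    where
    next : _ → _
    next (inj₁ (x<ρx , least)) = inj₁ (s≤s x<ρx , λ
      { (suc j) e (s≤s x<j) → s≤s (least j (relabel-complete (p ∘ suc) _ _ e) x<j) })
    next (inj₂ (max , min)) = inj₂ (
      (λ { zero _ → z≤n
         ; (suc j) e → s≤s (max j (relabel-complete (p ∘ suc) _ _ e)) }) ,
      (λ { zero e → contradiction (Fin.≤-antisym
             (min m (relabel-complete (p ∘ suc) _ _ (trans pm e)))
             (m-least _ (trans (relabel-sound (p ∘ suc) _ _ (proj₁ (s x))) (sym e)))) ρx≢m
         ; (suc j) e → s≤s (min j (relabel-complete (p ∘ suc) _ _ e)) }))

-- From walks of partitions to walks of permutations

CayleyAdj-sym : ∀ {n} (σ τ : Permutation′ n) → CayleyAdj σ τ → CayleyAdj τ σ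
CayleyAdj-sym σ τ (i , j , i≢j , e) = j , i , i≢j ∘ sym , λ x → transpose-sym i j (e x)

merge⇒cayley : ∀ {n} (p q : Partition n) σ τ → IsSigma p σ → IsSigma q τ → Merge p q → CayleyAdj σ τ
merge⇒cayley p q σ τ s t m@(mkMerge np nq p⪯q {a} {b} a≁b a~b only)
  with exit p q τ t (λ q⪯p → a≁b (q⪯p a b a~b))
... | i , exits = σ ⟨$⟩ʳ i , τ ⟨$⟩ʳ i ,
  (λ e → exits (trans (cong p (sym e)) (sigma-block p σ s i))) ,
  merge⇒transpose p q σ τ s t m i exits

hasse⇒cayley : ∀ {n} (p q : Partition n) σ τ → IsSigma p σ → IsSigma q τ → HasseAdj p q → CayleyAdj σ τ
hasse⇒cayley p q σ τ s t (inj₁ c) = merge⇒cayley p q σ τ s t (covers⇒merge p q τ t c)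
hasse⇒cayley p q σ τ s t (inj₂ c) =
  CayleyAdj-sym τ σ (merge⇒cayley q p τ σ t s (covers⇒merge q p σ s c))

-- Lengths are preserved, so every lower bound for Cayley walks applies to Hasse walks.
hasse-walk⇒cayley-walk : ∀ {n} (p q : Partition n) σ τ → IsSigma p σ → IsSigma q τ → ∀ {l} →
  Walk SamePartition HasseAdj p q l → Walk Perm._≈_ CayleyAdj σ τ l
hasse-walk⇒cayley-walk p q σ τ s t (here same) = here (sigma-unique p q σ τ s t same)
hasse-walk⇒cayley-walk p q σ τ s t (step {y = r} adj w) with sigma-exists r
... | ρ , u = step {y = ρ} (hasse⇒cayley p r σ ρ s u adj) (hasse-walk⇒cayley-walk r q ρ τ u t w)

-- Colourings of the meander system

-- Weaker than `HasComponents`: colours are constant on curves and all of them occur, but different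
-- curves may share a colour. Such data bound the number of curves from below and survive the gluing
-- of colours.
record Colouring {n} (σ τ : Permutation′ n) (m : ℕ) : Set where
  constructor mkColouring
  field
    colour  : Point n → Fin m
    hit     : ∀ k → ∃ λ u → colour u ≡ k
    upper   : ∀ i → colour (inj₂ i) ≡ colour (inj₁ (σ ⟨$⟩ʳ i))
    lower   : ∀ i → colour (inj₂ i) ≡ colour (inj₁ (τ ⟨$⟩ʳ i))

colouring-constant : ∀ {n} {σ τ : Permutation′ n} {m} (c : Colouring σ τ m) →
  let open Colouring c in ∀ {u v} → SameCurve σ τ u v → colour u ≡ colour v
colouring-constant c Star.ε = refl
colouring-constant c ((i , inj₁ (refl , inj₁ refl)) Star.◅ w) =
  trans (Colouring.upper c i) (colouring-constant c w)
colouring-constant c ((i , inj₁ (refl , inj₂ refl)) Star.◅ w) =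
  trans (Colouring.lower c i) (colouring-constant c w)
colouring-constant c ((i , inj₂ (refl , inj₁ refl)) Star.◅ w) =
  trans (sym (Colouring.upper c i)) (colouring-constant c w)
colouring-constant c ((i , inj₂ (refl , inj₂ refl)) Star.◅ w) =
  trans (sym (Colouring.lower c i)) (colouring-constant c w)

components-colouring : ∀ {n} {σ τ : Permutation′ n} {m} → HasComponents σ τ m → Colouring σ τ m
components-colouring (c , surj , iff) = mkColouring c
  (λ k → proj₁ (surj k) , proj₂ (surj k) refl)
  (λ i → from (iff _ _) ((i , inj₁ (refl , inj₁ refl)) Star.◅ Star.ε))
  (λ i → from (iff _ _) ((i , inj₁ (refl , inj₂ refl)) Star.◅ Star.ε))
  where open Equivalence

colouring-components : ∀ {n} {σ τ : Permutation′ n} {m} (c : Colouring σ τ m) →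
  let open Colouring c in (∀ u v → colour u ≡ colour v → SameCurve σ τ u v) → HasComponents σ τ m
colouring-components c complete = colour ,
  (λ k → proj₁ (hit k) , λ { refl → proj₂ (hit k) }) ,
  (λ u v → mk⇔ (complete u v) (colouring-constant c))
  where open Colouring c

-- One chosen point for each colour: points of different colours lie on different curves.
colouring≤components : ∀ {n} {σ τ : Permutation′ n} {m k} →
  Colouring σ τ m → HasComponents σ τ k → m ℕ.≤ k
colouring≤components c (d , _ , iff) =
  Fin.injective⇒≤ {f = λ y → d (proj₁ (hit y))} λ {y} {z} e →
    trans (sym (proj₂ (hit y)))
      (trans (colouring-constant c (Equivalence.to (iff _ _) e)) (proj₂ (hit z)))
  where open Colouring c

components-unique : ∀ {n} {σ τ : Permutation′ n} {k l} →
  HasComponents σ τ k → HasComponents σ τ l → k ≡ l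
components-unique {σ = σ} {τ} h h′ = ℕ.≤-antisym
  (colouring≤components (components-colouring {σ = σ} {τ} h) h′)
  (colouring≤components (components-colouring {σ = σ} {τ} h′) h)

-- The quotient map gluing `u` to `v`: the point `u` takes the place of `v`, and `punchOut`
-- renumbers what is left.
identify : ∀ {m} {u v : Fin (suc m)} → u ≢ v → Fin (suc m) → Fin m
identify {u = u} u≢v x with u ≟ x
... | yes _ = punchOut u≢v
... | no u≢x = punchOut u≢x

identify-identifies : ∀ {m} {u v : Fin (suc m)} (u≢v : u ≢ v) → identify u≢v u ≡ identify u≢v v
identify-identifies {u = u} {v} u≢v with u ≟ u | u ≟ v
... | no u≢u | _ = contradiction refl u≢u
... | yes _ | yes u≡v = contradiction u≡v u≢v
... | yes _ | no _ = Fin.punchOut-cong u refl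

identify-punchIn : ∀ {m} {u v : Fin (suc m)} (u≢v : u ≢ v) y → identify u≢v (punchIn u y) ≡ y
identify-punchIn {u = u} u≢v y with u ≟ punchIn u y
... | yes e = contradiction (sym e) (Fin.punchInᵢ≢i u y)
... | no _ = trans (Fin.punchOut-cong u refl) (Fin.punchOut-punchIn u)

transpose-invariant : ∀ {n} {A : Set} (f : Fin n → A) i j → f i ≡ f j →
  ∀ x → f (transpose i j ⟨$⟩ʳ x) ≡ f x
transpose-invariant f i j e x with x ≟ i
... | yes refl = sym e
... | no _ with x ≟ j
...   | yes refl = e
...   | no _ = refl

-- The upper arcs of `σ` and `ρ` differ only by exchanging the endpoints `L_i` and `L_j`. If these
-- have one colour the colouring serves both; otherwise gluing the two colours makes it do so, at
-- the cost of one.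
colouring-step : ∀ {n} {σ ρ τ : Permutation′ n} {m} → CayleyAdj σ ρ → Colouring ρ τ m →
  ∃ λ k → m ℕ.≤ suc k × Colouring σ τ k
colouring-step {ρ = ρ} {m = m} (i , j , _ , e) c with Colouring.colour c (inj₁ i) ≟ Colouring.colour c (inj₁ j)
... | yes ij = m , ℕ.n≤1+n m , mkColouring colour hit
        (λ x → trans (upper x) (trans (cong (colour ∘ inj₁) (e x)) (transpose-invariant (colour ∘ inj₁) i j ij _)))
        lower
  where open Colouring c
colouring-step {m = suc k} (i , j , _ , e) c | no i≢j =
  k , ℕ.≤-refl , mkColouring (f ∘ colour) hit′ upper′ (cong f ∘ lower)
  where
  open Colouring c
  f = identify i≢j
  hit′ : ∀ y → ∃ λ u → f (colour u) ≡ y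
  hit′ y with hit (punchIn (colour (inj₁ i)) y)
  ... | u , eq = u , trans (cong f eq) (identify-punchIn i≢j y)
  upper′ : ∀ x → f (colour (inj₂ x)) ≡ f (colour (inj₁ _))
  upper′ x = trans (cong f (trans (upper x) (cong (colour ∘ inj₁) (e x))))
    (transpose-invariant (f ∘ colour ∘ inj₁) i j (identify-identifies i≢j) _)
colouring-step {m = zero} (i , j , _ , e) c | no i≢j with () ← Colouring.colour c (inj₁ i)

walk-colouring : ∀ {n} {σ τ : Permutation′ n} {l} → Walk Perm._≈_ CayleyAdj σ τ l →
  ∃ λ m → n ℕ.≤ l + m × Colouring σ τ m
-- With equal upper and lower arcs every curve has exactly one L-point, which serves as its colour.
walk-colouring {n} {σ} {τ} (here same) = n , ℕ.≤-refl ,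
  mkColouring (λ { (inj₁ y) → y ; (inj₂ x) → τ ⟨$⟩ʳ x })
    (λ y → inj₁ y , refl) (sym ∘ same) (λ _ → refl)
walk-colouring {σ = σ} {τ} (step {y = ρ} {m = l} adj w) with walk-colouring w
... | m , n≤l+m , c with colouring-step {σ = σ} {ρ = ρ} {τ = τ} adj c
...   | k , m≤1+k , c′ = k , ℕ.≤-trans n≤l+m
        (ℕ.≤-trans (ℕ.+-monoʳ-≤ l m≤1+k) (ℕ.≤-reflexive (ℕ.+-suc l k))) , c′

walk-length≥ : ∀ {n} {σ τ : Permutation′ n} {k l} → HasComponents σ τ k →
  Walk Perm._≈_ CayleyAdj σ τ l → n ℕ.≤ l + k
walk-length≥ {l = l} h w with walk-colouring w
... | m , n≤l+m , c = ℕ.≤-trans n≤l+m (ℕ.+-monoʳ-≤ l (colouring≤components c h))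

-- Deleting an innermost arc

-- `R_i` stands between `L_i` and `L_{i+1}` on the line, so this says that `R_i` and `L_a` are
-- neighbours.
Near : ∀ {n} → Fin n → Fin n → Set
Near i a = i ≡ a ⊎ toℕ a ≡ suc (toℕ i)

near-≤ : ∀ {n} {i a : Fin n} → Near i a → i Fin.≤ a
near-≤ (inj₁ refl) = ℕ.≤-refl
near-≤ (inj₂ e) = ℕ.≤-trans (ℕ.n≤1+n _) (ℕ.≤-reflexive (sym e))

-- Search inwards: if `σ i` is not `i + 1`, then `k = i + 1` lies under the chord from `i` to `σ i`
-- but in another block, so `σ k` lies under it too. Either `k` is fixed, or the search continues
-- with the shorter chord from `k`. The number `g` bounds the length of the chord.
innermost-within : ∀ {n} (p : Partition n) σ → IsSigma p σ → Noncrossing p →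
  ∀ g i → i Fin.< σ ⟨$⟩ʳ i → toℕ (σ ⟨$⟩ʳ i) ℕ.≤ toℕ i + g → ∃ λ k → Near k (σ ⟨$⟩ʳ k)
innermost-within p σ s np zero i i<σi σi≤ =
  contradiction (ℕ.≤-trans σi≤ (ℕ.≤-reflexive (ℕ.+-identityʳ _))) (ℕ.<⇒≱ i<σi)
innermost-within {n} p σ s np (suc g) i i<σi σi≤ with ℕ.m≤n⇒m<n∨m≡n i<σi
... | inj₂ e = i , inj₂ (sym e)
... | inj₁ 1+i<σi = descend (<-cmp k (σ ⟨$⟩ʳ k))
  where
  1+i<n : suc (toℕ i) ℕ.< n
  1+i<n = ℕ.<-trans 1+i<σi (Fin.toℕ<n (σ ⟨$⟩ʳ i))
  k = fromℕ< 1+i<n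
  toℕ-k : toℕ k ≡ suc (toℕ i)
  toℕ-k = Fin.toℕ-fromℕ< 1+i<n
  i<k : i Fin.< k
  i<k = ℕ.≤-reflexive (sym toℕ-k)
  k<σi : k Fin.< σ ⟨$⟩ʳ i
  k<σi = subst (ℕ._< toℕ (σ ⟨$⟩ʳ i)) (sym toℕ-k) 1+i<σi
  k≁i : p k ≢ p i
  k≁i e = contradiction (proj₂ (sigma-next p σ s e i<k)) (ℕ.<⇒≱ k<σi)
  inside : Between i (σ ⟨$⟩ʳ i) (σ ⟨$⟩ʳ k)
  inside = noncrossing-between np (sym (sigma-block p σ s i)) (sym (sigma-block p σ s k)) k≁i (i<k , k<σi)

  descend : _ → ∃ λ k → Near k (σ ⟨$⟩ʳ k)
  descend (tri< k<σk _ _) = innermost-within p σ s np g k k<σk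
    (ℕ.≤-trans (ℕ.<⇒≤ (proj₂ inside)) (ℕ.≤-trans σi≤
      (ℕ.≤-reflexive (trans (ℕ.+-suc _ g) (cong (_+ g) (sym toℕ-k))))))
  descend (tri≈ _ e _) = k , inj₁ e
  -- No room is left for this case: `σ k` would lie strictly between `i` and `i + 1`.
  descend (tri> _ _ σk<k) = contradiction (subst (toℕ (σ ⟨$⟩ʳ k) ℕ.<_) toℕ-k σk<k)
    (ℕ.≤⇒≯ (proj₁ inside))

innermost : ∀ {n} (p : Partition (suc n)) σ → IsSigma p σ → Noncrossing p →
  ∃ λ k → Near k (σ ⟨$⟩ʳ k)
innermost p σ s np with <-cmp zero (σ ⟨$⟩ʳ zero)
... | tri< 0<σ0 _ _ = innermost-within p σ s np _ zero 0<σ0 ℕ.≤-refl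
... | tri≈ _ e _ = zero , inj₁ e

punchIn-mono-< : ∀ {n} (i : Fin (suc n)) {j k} → j Fin.< k → punchIn i j Fin.< punchIn i k
punchIn-mono-< i {j} {k} j<k = Fin.≤∧≢⇒< (Fin.punchIn-mono-≤ i j k (ℕ.<⇒≤ j<k))
  (λ e → ℕ.<-irrefl (cong toℕ (Fin.punchIn-injective i j k e)) j<k)

punchIn-cancel-< : ∀ {n} (i : Fin (suc n)) {j k} → punchIn i j Fin.< punchIn i k → j Fin.< k
punchIn-cancel-< i {j} {k} lt = ℕ.≰⇒> λ k≤j → ℕ.<⇒≱ lt (Fin.punchIn-mono-≤ i k j k≤j)

data PunchView {n} (i : Fin (suc n)) : Fin (suc n) → Set where
  hole  : PunchView i i
  other : ∀ y → PunchView i (punchIn i y)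

punchView : ∀ {n} (i x : Fin (suc n)) → PunchView i x
punchView i x with i ≟ x
... | yes refl = hole
... | no i≢x = subst (PunchView i) (Fin.punchIn-punchOut i≢x) (other (punchOut i≢x))

punchIn-suc : ∀ {n} (i j : Fin (suc n)) → toℕ j ≡ suc (toℕ i) → ∀ y →
  punchIn j y ≡ punchIn i y ⊎ (punchIn j y ≡ i × punchIn i y ≡ j)
punchIn-suc zero (suc zero) e zero = inj₂ (refl , refl)
punchIn-suc zero (suc zero) e (suc y) = inj₁ refl
punchIn-suc (suc i) (suc j) e zero = inj₁ refl
punchIn-suc (suc i) (suc j) e (suc y) with punchIn-suc i j (ℕ.suc-injective e) y
... | inj₁ eq = inj₁ (cong suc eq)
... | inj₂ (eq₁ , eq₂) = inj₂ (cong suc eq₁ , cong suc eq₂)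

punchIn-near : ∀ {n} {i a : Fin (suc n)} → Near i a → ∀ y →
  punchIn a y ≡ punchIn i y ⊎ (punchIn a y ≡ i × punchIn i y ≡ a)
punchIn-near (inj₁ refl) y = inj₁ refl
punchIn-near (inj₂ e) y = punchIn-suc _ _ e y

restrict : ∀ {n} → Fin (suc n) → Partition (suc n) → Partition n
restrict i p = relabel (p ∘ punchIn i)

restrict-noncrossing : ∀ {n} i (p : Partition (suc n)) → Noncrossing p → Noncrossing (restrict i p)
restrict-noncrossing i p = noncrossing-pullback p (punchIn i) (restrict i p) (Fin.punchIn-mono-≤ i)
  (relabel-sound (p ∘ punchIn i)) (relabel-complete (p ∘ punchIn i))

-- remove i σ deletes R_i and L_{σ i}; as σ i is i or i + 1, renumbering
-- the L-points and the R-points gives the same blocks.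
restrict-sigma : ∀ {n} i (p : Partition (suc n)) σ → IsSigma p σ → Near i (σ ⟨$⟩ʳ i) →
  IsSigma (restrict i p) (remove i σ)
restrict-sigma {n} i p σ s near x =
  relabel-complete (p ∘ g) _ _ (trans (sym (same-block _)) block) , next (proj₂ (s (g x)))
  where
  a = σ ⟨$⟩ʳ i
  g g′ : Fin n → Fin (suc n)
  g = punchIn i
  g′ = punchIn a
  ρx = remove i σ ⟨$⟩ʳ x
  σgx : σ ⟨$⟩ʳ g x ≡ g′ ρx
  σgx = punchIn-permute σ i x

  same-block : ∀ y → p (g′ y) ≡ p (g y)
  same-block y with punchIn-near near y
  ... | inj₁ e = cong p e
  ... | inj₂ (e , e′) = trans (cong p e) (trans (sym (sigma-block p σ s i)) (cong p (sym e′)))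

  g′≤g : ∀ y → g′ y Fin.≤ g y
  g′≤g y with punchIn-near near y
  ... | inj₁ e = ℕ.≤-reflexive (cong toℕ e)
  ... | inj₂ (e , e′) = subst₂ Fin._≤_ (sym e) (sym e′) (near-≤ near)

  g<g′ : ∀ y → g x Fin.< g y → g x Fin.< g′ y
  g<g′ y lt = by-cases (punchIn-near near y) near
    where
    by-cases : g′ y ≡ g y ⊎ (g′ y ≡ i × g y ≡ a) → Near i a → g x Fin.< g′ y
    by-cases (inj₁ e) _ = subst (g x Fin.<_) (sym e) lt
    by-cases (inj₂ (e , e′)) (inj₁ i≡a) = subst (g x Fin.<_) (trans e′ (trans (sym i≡a) (sym e))) lt
    -- Here `g y` is `i + 1` and `g′ y` is `i`. From `g x < i + 1` follows `g x < i`, because `g`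
    -- never takes the value `i`.
    by-cases (inj₂ (e , e′)) (inj₂ a≡1+i) = subst (g x Fin.<_) (sym e)
      (Fin.≤∧≢⇒< (ℕ.≤-pred (subst (toℕ (g x) ℕ.<_) (trans (cong toℕ e′) a≡1+i) lt))
        (Fin.punchInᵢ≢i i x))

  block : p (g′ ρx) ≡ p (g x)
  block = trans (cong p (sym σgx)) (sigma-block p σ s (g x))

  to-g : ∀ j → restrict i p j ≡ restrict i p x → p (g j) ≡ p (g x)
  to-g j = relabel-sound (p ∘ g) j x

  to-g′ : ∀ j → restrict i p j ≡ restrict i p x → p (g′ j) ≡ p (g x)
  to-g′ j e = trans (same-block j) (to-g j e)

  cancel : ∀ j → σ ⟨$⟩ʳ g x Fin.≤ g′ j → ρx Fin.≤ j
  cancel j le = Fin.punchIn-cancel-≤ a _ _ (subst (Fin._≤ g′ j) σgx le)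

  next : _ → _
  next (inj₁ (lt , least)) = inj₁
    ( punchIn-cancel-< i (ℕ.<-≤-trans (subst (g x Fin.<_) σgx lt) (g′≤g ρx))
    , λ j e x<j → cancel j (least (g′ j) (to-g′ j e) (g<g′ j (punchIn-mono-< i x<j))))
  next (inj₂ (max , min)) = inj₂
    ( (λ j e → Fin.punchIn-cancel-≤ i _ _ (max (g j) (to-g j e)))
    , (λ j e → cancel j (min (g′ j) (to-g′ j e))))

-- Inserting a point into the walks

-- The old labels are shifted by `suc`, so `zero` is a fresh label that makes `i` a singleton block.
isolate : ∀ {n} → Fin (suc n) → Partition n → Partition (suc n)
isolate i r = insertAt (suc ∘ r) i zero

isolate-in : ∀ {n} i (r : Partition n) x y → r x ≡ r y →
  isolate i r (punchIn i x) ≡ isolate i r (punchIn i y)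
isolate-in i r x y e = trans (insertAt-punchIn (suc ∘ r) i zero x)
  (trans (cong suc e) (sym (insertAt-punchIn (suc ∘ r) i zero y)))

isolate-out : ∀ {n} i (r : Partition n) x y → isolate i r (punchIn i x) ≡ isolate i r (punchIn i y) →
  r x ≡ r y
isolate-out i r x y e = Fin.suc-injective (trans (sym (insertAt-punchIn (suc ∘ r) i zero x))
  (trans e (insertAt-punchIn (suc ∘ r) i zero y)))

isolate-alone : ∀ {n} i (r : Partition n) y → isolate i r i ≢ isolate i r (punchIn i y)
isolate-alone i r y e with () ← trans (sym (insertAt-lookup (suc ∘ r) i zero))
  (trans e (insertAt-punchIn (suc ∘ r) i zero y))

isolate-⪯ : ∀ {n} i {r s : Partition n} → r ⪯ s → isolate i r ⪯ isolate i s
isolate-⪯ i {r} {s} r⪯s x y e with punchView i x | punchView i y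
... | hole | hole = refl
... | hole | other y′ = contradiction e (isolate-alone i r y′)
... | other x′ | hole = contradiction (sym e) (isolate-alone i r x′)
... | other x′ | other y′ = isolate-in i s x′ y′ (r⪯s x′ y′ (isolate-out i r x′ y′ e))

isolate-noncrossing : ∀ {n} i (r : Partition n) → Noncrossing r → Noncrossing (isolate i r)
isolate-noncrossing i r nr a b c d a<b b<c c<d ac bd
  with punchView i a | punchView i b | punchView i c | punchView i d
... | hole | _ | hole | _ = contradiction (ℕ.<-trans a<b b<c) (ℕ.<-irrefl refl)
... | hole | _ | other c′ | _ = contradiction ac (isolate-alone i r c′)
... | other a′ | _ | hole | _ = contradiction (sym ac) (isolate-alone i r a′)
... | _ | hole | _ | hole = contradiction (ℕ.<-trans b<c c<d) (ℕ.<-irrefl refl)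
... | _ | hole | _ | other d′ = contradiction bd (isolate-alone i r d′)
... | _ | other b′ | _ | hole = contradiction (sym bd) (isolate-alone i r b′)
... | other a′ | other b′ | other c′ | other d′ = isolate-in i r a′ b′
  (nr a′ b′ c′ d′ (punchIn-cancel-< i a<b) (punchIn-cancel-< i b<c) (punchIn-cancel-< i c<d)
    (isolate-out i r a′ c′ ac) (isolate-out i r b′ d′ bd))

isolate-merge : ∀ {n} i {r s : Partition n} → Merge r s → Merge (isolate i r) (isolate i s)
isolate-merge i {r} {s} (mkMerge nr ns r⪯s {a} {b} a≁b a~b only) =
  mkMerge (isolate-noncrossing i r nr) (isolate-noncrossing i s ns) (isolate-⪯ i r⪯s)
    (a≁b ∘ isolate-out i r a b) (isolate-in i s a b a~b) split
  where
  R = isolate i r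
  split : ∀ x y → isolate i s x ≡ isolate i s y →
    R x ≡ R y ⊎ (R x ≡ R (punchIn i a) × R y ≡ R (punchIn i b))
      ⊎ (R x ≡ R (punchIn i b) × R y ≡ R (punchIn i a))
  split x y e with punchView i x | punchView i y
  ... | hole | hole = inj₁ refl
  ... | hole | other y′ = contradiction e (isolate-alone i s y′)
  ... | other x′ | hole = contradiction (sym e) (isolate-alone i s x′)
  ... | other x′ | other y′ with only x′ y′ (isolate-out i s x′ y′ e)
  ...   | inj₁ xy = inj₁ (isolate-in i r x′ y′ xy)
  ...   | inj₂ (inj₁ (xa , yb)) = inj₂ (inj₁ (isolate-in i r x′ a xa , isolate-in i r y′ b yb))
  ...   | inj₂ (inj₂ (xb , ya)) = inj₂ (inj₂ (isolate-in i r x′ b xb , isolate-in i r y′ a ya))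

isolate-restrict-⪯ : ∀ {n} i (r : Partition (suc n)) → isolate i (restrict i r) ⪯ r
isolate-restrict-⪯ i r x y e with punchView i x | punchView i y
... | hole | hole = refl
... | hole | other y′ = contradiction e (isolate-alone i _ y′)
... | other x′ | hole = contradiction (sym e) (isolate-alone i _ x′)
... | other x′ | other y′ = relabel-sound (r ∘ punchIn i) x′ y′ (isolate-out i _ x′ y′ e)

-- Doubles the point `i`: `pinch i` sends both `inject₁ i` and `suc i` to it. The outer `suc` only
-- moves the labels into the larger type.
clone : ∀ {n} → Fin n → Partition n → Partition (suc n)
clone i r = suc ∘ r ∘ pinch i

pinch-punchIn : ∀ {n} (i : Fin n) y → pinch i (punchIn (inject₁ i) y) ≡ y
pinch-punchIn zero zero = refl
pinch-punchIn zero (suc y) = refl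
pinch-punchIn (suc i) zero = refl
pinch-punchIn (suc i) (suc y) = cong suc (pinch-punchIn i y)

punchIn-pinch : ∀ {n} (i : Fin n) x →
  punchIn (inject₁ i) (pinch i x) ≡ x ⊎ (x ≡ inject₁ i × punchIn (inject₁ i) (pinch i x) ≡ suc i)
punchIn-pinch zero zero = inj₂ (refl , refl)
punchIn-pinch zero (suc x) = inj₁ refl
punchIn-pinch (suc i) zero = inj₁ refl
punchIn-pinch (suc i) (suc x) with punchIn-pinch i x
... | inj₁ e = inj₁ (cong suc e)
... | inj₂ (e , e′) = inj₂ (cong suc e , cong suc e′)

clone-noncrossing : ∀ {n} (i : Fin n) (r : Partition n) → Noncrossing r → Noncrossing (clone i r)
clone-noncrossing i r = noncrossing-pullback r (pinch i) (clone i r)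
  (λ x y → Fin.pinch-mono-≤ i) (λ _ _ → Fin.suc-injective) (λ _ _ → cong suc)

clone-⪯ : ∀ {n} (i : Fin n) {r s : Partition n} → r ⪯ s → clone i r ⪯ clone i s
clone-⪯ i r⪯s x y e = cong suc (r⪯s _ _ (Fin.suc-injective e))

clone-merge : ∀ {n} (i : Fin n) {r s : Partition n} → Merge r s → Merge (clone i r) (clone i s)
clone-merge i {r} {s} (mkMerge nr ns r⪯s {a} {b} a≁b a~b only) =
  mkMerge (clone-noncrossing i r nr) (clone-noncrossing i s ns) (clone-⪯ i {r} {s} r⪯s)
    {punchIn (inject₁ i) a} {punchIn (inject₁ i) b}
    (λ e → a≁b (trans (sym (at r a)) (trans (Fin.suc-injective e) (at r b))))
    (cong suc (trans (at s a) (trans a~b (sym (at s b))))) split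
  where
  at : ∀ t y → t (pinch i (punchIn (inject₁ i) y)) ≡ t y
  at t y = cong t (pinch-punchIn i y)
  to : ∀ {x y} → r x ≡ r y → suc (r x) ≡ suc (r (pinch i (punchIn (inject₁ i) y)))
  to e = cong suc (trans e (sym (at r _)))
  split : ∀ x y → clone i s x ≡ clone i s y → _
  split x y e with only (pinch i x) (pinch i y) (Fin.suc-injective e)
  ... | inj₁ xy = inj₁ (cong suc xy)
  ... | inj₂ (inj₁ (xa , yb)) = inj₂ (inj₁ (to xa , to yb))
  ... | inj₂ (inj₂ (xb , ya)) = inj₂ (inj₂ (to xb , to ya))

-- A common interface for the two ways of undoing the deletion of an arc: a singleton is put back if
-- `a` is `i`, and a point is doubled if `a` is `i + 1`. It carries a walk between restricted
-- partitions back to the original ones.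
record Lifting {n} (i a : Fin (suc n)) : Set where
  field
    lift       : Partition n → Partition (suc n)
    lift-⪯     : ∀ {r s} → r ⪯ s → lift r ⪯ lift s
    lift-merge : ∀ {r s} → Merge r s → Merge (lift r) (lift s)
    lift-restrict : ∀ r ρ → IsSigma r ρ → ρ ⟨$⟩ʳ i ≡ a → SamePartition (lift (restrict i r)) r

lifting : ∀ {n} {i a : Fin (suc n)} → Near i a → Lifting i a
lifting {i = i} (inj₁ refl) = record
  { lift = isolate i ; lift-⪯ = isolate-⪯ i ; lift-merge = isolate-merge i
  ; lift-restrict = λ r ρ u fix → isolate-restrict-⪯ i r , from r (sigma-fixed r ρ u fix) }
  where
  from : ∀ r → (∀ {j} → r j ≡ r i → j ≡ i) → r ⪯ isolate i (restrict i r)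
  from r alone x y e with punchView i x | punchView i y
  ... | hole | hole = refl
  ... | hole | other y′ = contradiction (alone (sym e)) (Fin.punchInᵢ≢i i y′)
  ... | other x′ | hole = contradiction (alone e) (Fin.punchInᵢ≢i i x′)
  ... | other x′ | other y′ = isolate-in i _ x′ y′ (relabel-complete (r ∘ punchIn i) x′ y′ e)
lifting {n} {i} {suc k} (inj₂ e)
  with refl ← Fin.toℕ-injective {i = i} {inject₁ k} (trans (sym (ℕ.suc-injective e)) (sym (Fin.toℕ-inject₁ k))) = record
  { lift = clone k ; lift-⪯ = λ {r} {s} → clone-⪯ k {r} {s} ; lift-merge = clone-merge k
  ; lift-restrict = λ r ρ u ρi≡1+k →
      let fold = folded r (trans (cong r (sym ρi≡1+k)) (sigma-block r ρ u (inject₁ k))) in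
      (λ x y e′ → trans (sym (fold x))
        (trans (relabel-sound (r ∘ punchIn (inject₁ k)) _ _ (Fin.suc-injective e′)) (fold y))) ,
      (λ x y e′ → cong suc (relabel-complete (r ∘ punchIn (inject₁ k)) _ _
        (trans (fold x) (trans e′ (sym (fold y)))))) }
  where
  folded : ∀ (r : Partition (suc n)) → r (suc k) ≡ r (inject₁ k) →
    ∀ x → r (punchIn (inject₁ k) (pinch k x)) ≡ r x
  folded r ~ x with punchIn-pinch k x
  ... | inj₁ eq = cong r eq
  ... | inj₂ (eq , eq′) = trans (cong r eq′) (trans ~ (cong r (sym eq)))

MergeWalk : ∀ {n} → Partition n → Partition n → ℕ → Set
MergeWalk = Walk SamePartition MergeAdj

mergeWalk-resp : ∀ {n} {p p′ q q′ : Partition n} {l} → SamePartition p p′ → SamePartition q q′ →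
  MergeWalk p q l → MergeWalk p′ q′ l
mergeWalk-resp pp′ qq′ (here pq) =
  here (SamePartition-trans (SamePartition-sym pp′) (SamePartition-trans pq qq′))
mergeWalk-resp pp′ qq′ (step (inj₁ m) w) =
  step (inj₁ (merge-resp pp′ SamePartition-refl m)) (mergeWalk-resp SamePartition-refl qq′ w)
mergeWalk-resp pp′ qq′ (step (inj₂ m) w) =
  step (inj₂ (merge-resp SamePartition-refl pp′ m)) (mergeWalk-resp SamePartition-refl qq′ w)

mergeWalk-snoc : ∀ {n} {p q r : Partition n} {l} → MergeWalk p q l → MergeAdj q r → MergeWalk p r (suc l)
mergeWalk-snoc (here pq) (inj₁ m) =
  step (inj₁ (merge-resp (SamePartition-sym pq) SamePartition-refl m)) (here SamePartition-refl)
mergeWalk-snoc (here pq) (inj₂ m) =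
  step (inj₂ (merge-resp SamePartition-refl (SamePartition-sym pq) m)) (here SamePartition-refl)
mergeWalk-snoc (step adj w) m = step adj (mergeWalk-snoc w m)

mergeWalk-lift : ∀ {n} {i a : Fin (suc n)} (L : Lifting i a) → let open Lifting L in
  ∀ {p q l} → MergeWalk p q l → MergeWalk (lift p) (lift q) l
mergeWalk-lift L (here (pq , qp)) = here (Lifting.lift-⪯ L pq , Lifting.lift-⪯ L qp)
mergeWalk-lift L (step (inj₁ m) w) = step (inj₁ (Lifting.lift-merge L m)) (mergeWalk-lift L w)
mergeWalk-lift L (step (inj₂ m) w) = step (inj₂ (Lifting.lift-merge L m)) (mergeWalk-lift L w)

mergeWalk⇒hasseWalk : ∀ {n} {p q : Partition n} {l} → MergeWalk p q l → Walk SamePartition HasseAdj p q l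
mergeWalk⇒hasseWalk (here pq) = here pq
mergeWalk⇒hasseWalk (step (inj₁ m) w) = step (inj₁ (merge⇒covers m)) (mergeWalk⇒hasseWalk w)
mergeWalk⇒hasseWalk (step (inj₂ m) w) = step (inj₂ (merge⇒covers m)) (mergeWalk⇒hasseWalk w)

-- Splitting off a curve

-- A partition one merge away from `q` whose permutation has the arc from `R_i` to `L_a`. By
-- `transposed`, its lower arcs arise from those of `τ` by exchanging the endpoints `L_{τ i}` and
-- `L_a`.
record Surgery {n} (q : Partition n) (τ : Permutation′ n) (i a : Fin n) : Set where
  constructor mkSurgery
  field
    q′          : Partition n
    τ′          : Permutation′ n
    noncrossing : Noncrossing q′
    isSigma     : IsSigma q′ τ′
    adjacent    : MergeAdj q′ q
    τ′i≡a       : τ′ ⟨$⟩ʳ i ≡ a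
    transposed  : ∀ x → τ′ ⟨$⟩ʳ x ≡ transpose (τ ⟨$⟩ʳ i) a ⟨$⟩ʳ (τ ⟨$⟩ʳ x)

isolate-restrict-merge : ∀ {n} i (q : Partition (suc n)) → Noncrossing q → ∀ b → b ≢ i → q b ≡ q i →
  Merge (isolate i (restrict i q)) q
isolate-restrict-merge i q nq b b≢i b~i with punchView i b
... | hole = contradiction refl b≢i
... | other b′ = mkMerge (isolate-noncrossing i r (restrict-noncrossing i q nq)) nq
        (isolate-restrict-⪯ i q) {i} {punchIn i b′} (isolate-alone i r b′) (sym b~i) split
  where
  r = restrict i q
  in-r : ∀ x y → q (punchIn i x) ≡ q (punchIn i y) → isolate i r (punchIn i x) ≡ isolate i r (punchIn i y)
  in-r x y = isolate-in i r x y ∘ relabel-complete (q ∘ punchIn i) x y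
  split : ∀ x y → q x ≡ q y → _
  split x y e with punchView i x | punchView i y
  ... | hole | hole = inj₁ refl
  ... | hole | other y′ = inj₂ (inj₁ (refl , in-r y′ b′ (trans (sym e) (sym b~i))))
  ... | other x′ | hole = inj₂ (inj₂ (in-r x′ b′ (trans e (sym b~i)) , refl))
  ... | other x′ | other y′ = inj₁ (in-r x′ y′ e)

surgery : ∀ {n} (q : Partition (suc n)) τ → Noncrossing q → IsSigma q τ → ∀ {i a} →
  Near i a → τ ⟨$⟩ʳ i ≢ a → Surgery q τ i a
surgery q τ nq t {i} (inj₁ refl) τi≢i with sigma-exists (isolate i (restrict i q))
... | τ′ , t′ = mkSurgery q′ τ′ (Merge.noncrossing-fine m) t′ (inj₁ m) τ′i≡i transposed
  where
  q′ = isolate i (restrict i q)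
  m : Merge q′ q
  m = isolate-restrict-merge i q nq (τ ⟨$⟩ʳ i) τi≢i (sigma-block q τ t i)
  alone : ∀ x → q′ x ≡ q′ i → x ≡ i
  alone x e with punchView i x
  ... | hole = refl
  ... | other x′ = contradiction (sym e) (isolate-alone i _ x′)
  τ′i≡i : τ′ ⟨$⟩ʳ i ≡ i
  τ′i≡i = alone _ (sigma-block q′ τ′ t′ i)
  transposed : ∀ x → τ′ ⟨$⟩ʳ x ≡ transpose (τ ⟨$⟩ʳ i) i ⟨$⟩ʳ (τ ⟨$⟩ʳ x)
  -- Here `q′` is the finer partition, so the transposition taking `τ′` to `τ` has to be inverted.
  transposed x = trans
    (transpose-sym (τ′ ⟨$⟩ʳ i) (τ ⟨$⟩ʳ i) (merge⇒transpose q′ q τ′ τ t′ t m i (τi≢i ∘ alone _) x))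
    (cong (λ z → transpose (τ ⟨$⟩ʳ i) z ⟨$⟩ʳ (τ ⟨$⟩ʳ x)) τ′i≡i)
surgery q τ nq t {i} {a} (inj₂ a≡1+i) τi≢a with sigma-exists (mergeBlocks q i a)
... | τ′ , t′ = mkSurgery q′ τ′ nq′ t′ (inj₂ m) τ′i≡a transposed
  where
  q′ = mergeBlocks q i a
  i<a : i Fin.< a
  i<a = ℕ.≤-reflexive (sym a≡1+i)
  next-a : ∀ {x} → i Fin.< x → x Fin.≤ a → x ≡ a
  next-a i<x x≤a = Fin.≤-antisym x≤a (subst (ℕ._≤ _) (sym a≡1+i) i<x)
  i≁a : q i ≢ q a
  i≁a e with sigma-next q τ t (sym e) i<a
  ... | i<τi , τi≤a = τi≢a (next-a i<τi τi≤a)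
  -- No point lies between `i` and `i + 1`, so a chord separating them would have to end at one of
  -- them.
  same-side : ∀ u v → q u ≡ q v → q u ≢ q i → q u ≢ q a →
    (Between u v i → Between u v a) × (Between u v a → Between u v i)
  same-side u v uv u≁i u≁a =
    (λ { (u<i , i<v) → ℕ.<-trans u<i i<a ,
           Fin.≤∧≢⇒< (subst (ℕ._≤ toℕ v) (sym a≡1+i) i<v) (λ { refl → u≁a uv }) }) ,
    (λ { (u<a , a<v) → Fin.≤∧≢⇒< (ℕ.≤-pred (subst (toℕ u ℕ.<_) a≡1+i u<a)) (u≁i ∘ cong q) ,
           ℕ.<-trans i<a a<v })
  nq′ : Noncrossing q′
  nq′ = mergeBlocks-noncrossing q i a nq same-side
  m : Merge q q′
  m = mergeBlocks-merge q i a nq i≁a nq′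
  τ′i≡a : τ′ ⟨$⟩ʳ i ≡ a
  τ′i≡a with sigma-next q′ τ′ t′ (sym (mergeBlocks-joined q i a)) i<a
  ... | i<τ′i , τ′i≤a = next-a i<τ′i τ′i≤a
  transposed : ∀ x → τ′ ⟨$⟩ʳ x ≡ transpose (τ ⟨$⟩ʳ i) a ⟨$⟩ʳ (τ ⟨$⟩ʳ x)
  transposed x = trans
    (merge⇒transpose q q′ τ τ′ t t′ m i (λ e → i≁a (trans (sym e) (cong q τ′i≡a))) x)
    (cong (λ z → transpose (τ ⟨$⟩ʳ i) z ⟨$⟩ʳ (τ ⟨$⟩ʳ x)) τ′i≡a)

-- Counting curves

Arc-sym : ∀ {n} {σ τ : Permutation′ n} {u v} → Arc σ τ u v → Arc σ τ v u
Arc-sym (i , inj₁ e) = i , inj₂ e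
Arc-sym (i , inj₂ e) = i , inj₁ e

SameCurve-sym : ∀ {n} {σ τ : Permutation′ n} {u v} → SameCurve σ τ u v → SameCurve σ τ v u
SameCurve-sym {σ = σ} {τ} = Star.reverse (Arc-sym {σ = σ} {τ})

upper-arc : ∀ {n} {σ τ : Permutation′ n} {y} i → σ ⟨$⟩ʳ i ≡ y → SameCurve σ τ (inj₂ i) (inj₁ y)
upper-arc i refl = (i , inj₁ (refl , inj₁ refl)) Star.◅ Star.ε

lower-arc : ∀ {n} {σ τ : Permutation′ n} {y} i → τ ⟨$⟩ʳ i ≡ y → SameCurve σ τ (inj₂ i) (inj₁ y)
lower-arc i refl = (i , inj₁ (refl , inj₂ refl)) Star.◅ Star.ε

curve-map : ∀ {m n} {ρ υ : Permutation′ m} {σ τ : Permutation′ n} (f : Point m → Point n) →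
  (∀ x → SameCurve σ τ (f (inj₂ x)) (f (inj₁ (ρ ⟨$⟩ʳ x)))) →
  (∀ x → SameCurve σ τ (f (inj₂ x)) (f (inj₁ (υ ⟨$⟩ʳ x)))) →
  ∀ {u v} → SameCurve ρ υ u v → SameCurve σ τ (f u) (f v)
curve-map {ρ = ρ} {υ} {σ} {τ} f up down = go
  where
  go : ∀ {u v} → SameCurve ρ υ u v → SameCurve σ τ (f u) (f v)
  go Star.ε = Star.ε
  go ((x , inj₁ (refl , inj₁ refl)) Star.◅ w) = up x Star.◅◅ go w
  go ((x , inj₁ (refl , inj₂ refl)) Star.◅ w) = down x Star.◅◅ go w
  go ((x , inj₂ (refl , inj₁ refl)) Star.◅ w) = SameCurve-sym {σ = σ} {τ} (up x) Star.◅◅ go w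
  go ((x , inj₂ (refl , inj₂ refl)) Star.◅ w) = SameCurve-sym {σ = σ} {τ} (down x) Star.◅◅ go w

module _ {n} (i a : Fin (suc n)) where

  embed : Point n → Point (suc n)
  embed (inj₁ y) = inj₁ (punchIn a y)
  embed (inj₂ x) = inj₂ (punchIn i x)

  module _ {A : Set} (c : Point n → A) (z : A) where

    -- The two deleted points `L_a` and `R_i` are joined by an upper arc, so they receive the same
    -- colour `z`: a fresh one if they form a curve of their own, the colour of `L_b` if they are
    -- spliced into a curve.
    extend : Point (suc n) → A
    extend (inj₁ y) = insertAt (c ∘ inj₁) a z y
    extend (inj₂ x) = insertAt (c ∘ inj₂) i z x

    extend-embed : ∀ u → extend (embed u) ≡ c u
    extend-embed (inj₁ y) = insertAt-punchIn (c ∘ inj₁) a z y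
    extend-embed (inj₂ x) = insertAt-punchIn (c ∘ inj₂) i z x

    extend-L : extend (inj₁ a) ≡ z
    extend-L = insertAt-lookup (c ∘ inj₁) a z

    extend-R : extend (inj₂ i) ≡ z
    extend-R = insertAt-lookup (c ∘ inj₂) i z

  module _ (σ τ : Permutation′ (suc n)) (ρ υ : Permutation′ n)
    (σi≡a : σ ⟨$⟩ʳ i ≡ a) (σ-punchIn : ∀ x → σ ⟨$⟩ʳ punchIn i x ≡ punchIn a (ρ ⟨$⟩ʳ x)) where

    embed-upper : ∀ x → SameCurve σ τ (embed (inj₂ x)) (embed (inj₁ (ρ ⟨$⟩ʳ x)))
    embed-upper x = upper-arc {σ = σ} {τ} (punchIn i x) (σ-punchIn x)

    extend-upper : ∀ {A : Set} (c : Point n → A) z → (∀ x → c (inj₂ x) ≡ c (inj₁ (ρ ⟨$⟩ʳ x))) →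
      ∀ x → extend c z (inj₂ x) ≡ extend c z (inj₁ (σ ⟨$⟩ʳ x))
    extend-upper c z up x with punchView i x
    ... | hole = trans (extend-R c z) (sym (trans (cong (extend c z ∘ inj₁) σi≡a) (extend-L c z)))
    ... | other x′ = trans (extend-embed c z (inj₂ x′)) (trans (up x′)
      (sym (trans (cong (extend c z ∘ inj₁) (σ-punchIn x′)) (extend-embed c z (inj₁ _)))))

    -- The upper and the lower arc both join `R_i` to `L_a`, so these two points form a closed curve
    -- by themselves; it gets the new colour `zero`.
    components-suc : ∀ {k} → τ ⟨$⟩ʳ i ≡ a → (∀ x → τ ⟨$⟩ʳ punchIn i x ≡ punchIn a (υ ⟨$⟩ʳ x)) →
      HasComponents ρ υ k → HasComponents σ τ (suc k)
    components-suc {k} τi≡a τ-punchIn h@(c , _ , iff) =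
      colouring-components {σ = σ} {τ} (mkColouring colour hit (extend-upper (suc ∘ c) zero (cong suc ∘ upper)) lower′) complete
      where
      open Colouring (components-colouring {σ = ρ} {υ} h) using (upper; lower)
      c⁺ = suc ∘ c
      colour = extend c⁺ zero

      hit : ∀ y → ∃ λ u → colour u ≡ y
      hit zero = inj₁ a , extend-L c⁺ zero
      hit (suc y) with Colouring.hit (components-colouring {σ = ρ} {υ} h) y
      ... | u , e = embed u , trans (extend-embed c⁺ zero u) (cong suc e)

      lower′ : ∀ x → colour (inj₂ x) ≡ colour (inj₁ (τ ⟨$⟩ʳ x))
      lower′ x with punchView i x
      ... | hole = trans (extend-R c⁺ zero) (sym (trans (cong (colour ∘ inj₁) τi≡a) (extend-L c⁺ zero)))
      ... | other x′ = trans (extend-embed c⁺ zero (inj₂ x′)) (trans (cong suc (lower x′))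
        (sym (trans (cong (colour ∘ inj₁) (τ-punchIn x′)) (extend-embed c⁺ zero (inj₁ _)))))

      locate : ∀ u → (colour u ≡ zero × SameCurve σ τ (inj₂ i) u) ⊎ ∃ λ u′ → u ≡ embed u′ × colour u ≡ suc (c u′)
      locate (inj₁ y) with punchView a y
      ... | hole = inj₁ (extend-L c⁺ zero , upper-arc {σ = σ} {τ} i σi≡a)
      ... | other y′ = inj₂ (inj₁ y′ , refl , extend-embed c⁺ zero (inj₁ y′))
      locate (inj₂ x) with punchView i x
      ... | hole = inj₁ (extend-R c⁺ zero , Star.ε)
      ... | other x′ = inj₂ (inj₂ x′ , refl , extend-embed c⁺ zero (inj₂ x′))

      complete : ∀ u v → colour u ≡ colour v → SameCurve σ τ u v
      complete u v e with locate u | locate v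
      ... | inj₁ (_ , iu) | inj₁ (_ , iv) = SameCurve-sym {σ = σ} {τ} iu Star.◅◅ iv
      ... | inj₁ (u0 , _) | inj₂ (_ , _ , vs) with () ← trans (sym u0) (trans e vs)
      ... | inj₂ (_ , _ , us) | inj₁ (v0 , _) with () ← trans (sym v0) (trans (sym e) us)
      ... | inj₂ (u′ , refl , us) | inj₂ (v′ , refl , vs) =
        curve-map {ρ = ρ} {υ} {σ} {τ} embed embed-upper
          (λ x → lower-arc {σ = σ} {τ} (punchIn i x) (τ-punchIn x))
          (Equivalence.to (iff u′ v′) (Fin.suc-injective (trans (sym us) (trans e vs))))

    -- The lower arc out of R_i is spliced with the one into L_a.
    components-splice : ∀ {k} b → τ ⟨$⟩ʳ i ≡ punchIn a b →
      (∀ x → τ ⟨$⟩ʳ punchIn i x ≡ punchIn a (υ ⟨$⟩ʳ x) ⊎ (τ ⟨$⟩ʳ punchIn i x ≡ a × υ ⟨$⟩ʳ x ≡ b)) →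
      HasComponents ρ υ k → HasComponents σ τ k
    components-splice b τi≡b τ-punchIn h@(c , _ , iff) =
      colouring-components {σ = σ} {τ} (mkColouring colour hit (extend-upper c z upper) lower′) complete
      where
      open Colouring (components-colouring {σ = ρ} {υ} h) using (upper; lower)
      z = c (inj₁ b)
      colour = extend c z

      hit : ∀ y → ∃ λ u → colour u ≡ y
      hit y with Colouring.hit (components-colouring {σ = ρ} {υ} h) y
      ... | u , e = embed u , trans (extend-embed c z u) e

      lower′ : ∀ x → colour (inj₂ x) ≡ colour (inj₁ (τ ⟨$⟩ʳ x))
      lower′ x with punchView i x
      ... | hole = trans (extend-R c z)
        (sym (trans (cong (colour ∘ inj₁) τi≡b) (extend-embed c z (inj₁ b))))
      ... | other x′ with τ-punchIn x′
      ...   | inj₁ e = trans (extend-embed c z (inj₂ x′)) (trans (lower x′)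
        (sym (trans (cong (colour ∘ inj₁) e) (extend-embed c z (inj₁ _)))))
      ...   | inj₂ (e , e′) = trans (extend-embed c z (inj₂ x′)) (trans (lower x′)
        (trans (cong (c ∘ inj₁) e′) (sym (trans (cong (colour ∘ inj₁) e) (extend-L c z)))))

      R-to-b : SameCurve σ τ (inj₂ i) (embed (inj₁ b))
      R-to-b = lower-arc {σ = σ} {τ} i τi≡b
      L-to-b : SameCurve σ τ (inj₁ a) (embed (inj₁ b))
      L-to-b = SameCurve-sym {σ = σ} {τ} (upper-arc {σ = σ} {τ} i σi≡a) Star.◅◅ R-to-b

      locate : ∀ u → ∃ λ u′ → colour u ≡ c u′ × SameCurve σ τ u (embed u′)
      locate (inj₁ y) with punchView a y
      ... | hole = inj₁ b , extend-L c z , L-to-b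
      ... | other y′ = inj₁ y′ , extend-embed c z (inj₁ y′) , Star.ε
      locate (inj₂ x) with punchView i x
      ... | hole = inj₁ b , extend-R c z , R-to-b
      ... | other x′ = inj₂ x′ , extend-embed c z (inj₂ x′) , Star.ε

      embed-lower : ∀ x → SameCurve σ τ (embed (inj₂ x)) (embed (inj₁ (υ ⟨$⟩ʳ x)))
      embed-lower x with τ-punchIn x
      ... | inj₁ e = lower-arc {σ = σ} {τ} (punchIn i x) e
      ... | inj₂ (e , refl) = lower-arc {σ = σ} {τ} (punchIn i x) e Star.◅◅ L-to-b

      complete : ∀ u v → colour u ≡ colour v → SameCurve σ τ u v
      complete u v e with locate u | locate v
      ... | u′ , us , uw | v′ , vs , vw = uw Star.◅◅
        curve-map {ρ = ρ} {υ} {σ} {τ} embed embed-upper embed-lower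
          (Equivalence.to (iff u′ v′) (trans (sym us) (trans e vs)))
        Star.◅◅ SameCurve-sym {σ = σ} {τ} vw

-- Shortest walks and the equivalence

record Geodesic {n} (p q : Partition n) (σ τ : Permutation′ n) : Set where
  constructor mkGeodesic
  field
    curves len    : ℕ
    -- This is equality in the bound `walk-length≥`, so the walk is as short as possible.
    curves+len≡n  : curves + len ≡ n
    hasComponents : HasComponents σ τ curves
    walk          : MergeWalk p q len

geodesic : ∀ {n} (p q : Partition n) σ τ → Noncrossing p → Noncrossing q →
  IsSigma p σ → IsSigma q τ → Geodesic p q σ τ
geodesic {zero} p q σ τ np nq s t = mkGeodesic 0 0 refl
  ((λ { (inj₁ ()) ; (inj₂ ()) }) , (λ ()) , λ { (inj₁ ()) ; (inj₂ ()) })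
  (here ((λ ()) , (λ ())))
geodesic {suc n} p q σ τ np nq s t with innermost p σ s np
... | i , near = cases (τ ⟨$⟩ʳ i ≟ a)
  where
  a = σ ⟨$⟩ʳ i
  ρ = remove i σ
  L = lifting near
  open Lifting L

  smaller : ∀ q′ τ′ → Noncrossing q′ → IsSigma q′ τ′ → τ′ ⟨$⟩ʳ i ≡ a →
    Geodesic (restrict i p) (restrict i q′) ρ (remove i τ′)
  smaller q′ τ′ nq′ t′ τ′i≡a = geodesic (restrict i p) (restrict i q′) ρ (remove i τ′)
    (restrict-noncrossing i p np) (restrict-noncrossing i q′ nq′)
    (restrict-sigma i p σ s near) (restrict-sigma i q′ τ′ t′ (subst (Near i) (sym τ′i≡a) near))

  lifted : ∀ q′ τ′ → IsSigma q′ τ′ → τ′ ⟨$⟩ʳ i ≡ a → ∀ {l} →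
    MergeWalk (restrict i p) (restrict i q′) l → MergeWalk p q′ l
  lifted q′ τ′ t′ τ′i≡a w =
    mergeWalk-resp (lift-restrict p σ s refl) (lift-restrict q′ τ′ t′ τ′i≡a) (mergeWalk-lift L w)

  remove-punchIn : ∀ τ′ → τ′ ⟨$⟩ʳ i ≡ a → ∀ x → τ′ ⟨$⟩ʳ punchIn i x ≡ punchIn a (remove i τ′ ⟨$⟩ʳ x)
  remove-punchIn τ′ τ′i≡a x = trans (punchIn-permute τ′ i x)
    (cong (λ z → punchIn z (remove i τ′ ⟨$⟩ʳ x)) τ′i≡a)

  cases : _ → Geodesic p q σ τ
  -- The deleted arcs form one more curve, and the walk lifts with its length unchanged.
  cases (yes τi≡a) with smaller q τ nq t τi≡a
  ... | mkGeodesic k l k+l≡n h w = mkGeodesic (suc k) l (cong suc k+l≡n)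
    (components-suc i a σ τ ρ (remove i τ) refl (punchIn-permute σ i) τi≡a (remove-punchIn τ τi≡a) h)
    (lifted q τ t τi≡a w)
  -- Splicing keeps the number of curves of the smaller system, and the walk becomes longer by the
  -- step from `q′` to `q`.
  cases (no τi≢a) with surgery q τ nq t near τi≢a
  ... | mkSurgery q′ τ′ nq′ t′ adj τ′i≡a transposed with smaller q′ τ′ nq′ t′ τ′i≡a
  ...   | mkGeodesic k l k+l≡n h w = mkGeodesic k (suc l) (trans (ℕ.+-suc k l) (cong suc k+l≡n))
    (components-splice i a σ τ ρ (remove i τ′) refl (punchIn-permute σ i) b (sym punchIn-b) τ-punchIn h)
    (mergeWalk-snoc (lifted q′ τ′ t′ τ′i≡a w) adj)
    where
    -- The index of `L_{τ i}` after `L_a` has been deleted.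
    b = punchOut (τi≢a ∘ sym)
    punchIn-b : punchIn a b ≡ τ ⟨$⟩ʳ i
    punchIn-b = Fin.punchIn-punchOut (τi≢a ∘ sym)
    -- Only the lower arc that ended at `L_a` is rerouted, to `L_{τ i}`; all others outside `R_i`
    -- are the same for `τ` and `τ′`.
    τ-punchIn : ∀ x → τ ⟨$⟩ʳ punchIn i x ≡ punchIn a (remove i τ′ ⟨$⟩ʳ x)
      ⊎ (τ ⟨$⟩ʳ punchIn i x ≡ a × remove i τ′ ⟨$⟩ʳ x ≡ b)
    τ-punchIn x with τ ⟨$⟩ʳ punchIn i x ≟ a
    ... | no ≢a = inj₁ (trans
      (sym (trans (transposed (punchIn i x)) (transpose-other (τ ⟨$⟩ʳ i) a
        (λ e → Fin.punchInᵢ≢i i x (permutation-injective τ e)) ≢a)))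
      (remove-punchIn τ′ τ′i≡a x))
    ... | yes ≡a = inj₂ (≡a , Fin.punchIn-injective a _ _ (trans (sym (remove-punchIn τ′ τ′i≡a x))
      (trans (transposed (punchIn i x))
        (trans (cong (transpose (τ ⟨$⟩ʳ i) a ⟨$⟩ʳ_) ≡a)
          (trans (transposeʳ (τ ⟨$⟩ʳ i) a) (sym punchIn-b))))))

theorem3p2 : ∀ (n : ℕ) → 1 ≤ n →
    ∀ (p q : Partition n) → Noncrossing p → Noncrossing q →
    ∀ (σ τ : Permutation′ n) → IsSigma p σ → IsSigma q τ →
    (∀ (k : ℤ) →
    (Π₀≡ σ τ k ⇔ d≡ σ τ (+ n - k)) × (d≡ σ τ (+ n - k) ⇔ dΛ≡ p q (+ n - k)))
    × (Π₀≡ σ τ (+ 1) ⇔ (d≡ σ τ (+ n - + 1) × dΛ≡ p q (+ n - + 1)))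
theorem3p2 n _ p q np nq σ τ s t with geodesic p q σ τ np nq s t
-- Matching on `refl` turns `n` into `K + l`. Each of the three conditions is then shown to be
-- equivalent to `k ≡ + K`.
... | mkGeodesic K l refl h w =
  (λ k → mk⇔ (d-from k ∘ Π₀-to k) (Π₀-from k ∘ d-to k) , mk⇔ (dΛ-from k ∘ d-to k) (d-from k ∘ dΛ-to k)) ,
  mk⇔ (λ x → d-from _ (Π₀-to _ x) , dΛ-from _ (Π₀-to _ x)) (λ x → Π₀-from _ (d-to _ (proj₁ x)))
  where
  Λ-walk : Walk SamePartition HasseAdj p q l
  Λ-walk = mergeWalk⇒hasseWalk w

  l≤ : ∀ {l′} → Walk Perm._≈_ CayleyAdj σ τ l′ → l ≤ l′
  l≤ {l′} w′ = ℕ.+-cancelˡ-≤ K l l′ (subst (K + l ≤_) (ℕ.+-comm l′ K) (walk-length≥ h w′))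

  -- The Hasse walk of length `l` also gives a Cayley walk of length `l`, and no Cayley walk is
  -- shorter; hence both distances equal `l`.
  d-l : IsDist Perm._≈_ CayleyAdj σ τ l
  d-l = hasse-walk⇒cayley-walk p q σ τ s t Λ-walk , λ _ → l≤

  dΛ-l : IsDist SamePartition HasseAdj p q l
  dΛ-l = Λ-walk , λ _ → l≤ ∘ hasse-walk⇒cayley-walk p q σ τ s t

  n-K : + (K + l) - + K ≡ + l
  n-K = trans (ℤ.m-n≡m⊖n (K + l) K) (trans (ℤ.⊖-≥ (ℕ.m≤m+n K l)) (cong +_ (ℕ.m+n∸m≡n K l)))

  solve-k : ∀ k → + (K + l) - k ≡ + l → k ≡ + K
  solve-k k e = ℤ.neg-injective (∙-cancelˡ (+ (K + l)) (- k) (- + K) (trans e (sym n-K)))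

  Π₀-to : ∀ k → Π₀≡ σ τ k → k ≡ + K
  Π₀-to k (m , k≡m , h′) = trans k≡m (cong +_ (components-unique {σ = σ} {τ} h′ h))
  Π₀-from : ∀ k → k ≡ + K → Π₀≡ σ τ k
  Π₀-from k e = K , e , h

  d-to : ∀ k → d≡ σ τ (+ (K + l) - k) → k ≡ + K
  d-to k (m , e , w′ , least) = solve-k k (trans e (cong +_ (ℕ.≤-antisym (least l (proj₁ d-l)) (l≤ w′))))
  d-from : ∀ k → k ≡ + K → d≡ σ τ (+ (K + l) - k)
  d-from k refl = l , n-K , d-l

  dΛ-to : ∀ k → dΛ≡ p q (+ (K + l) - k) → k ≡ + K
  dΛ-to k (m , e , w′ , least) = solve-k k
    (trans e (cong +_ (ℕ.≤-antisym (least l Λ-walk) (proj₂ dΛ-l m w′))))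
  dΛ-from : ∀ k → k ≡ + K → dΛ≡ p q (+ (K + l) - k)
  dΛ-from k refl = l , n-K , dΛ-l
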